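{- There exists a linear-time algorithm whose input is a graph $G$ that does not contain a cycle with a unique chord and whose output is a maximum clique of $G$.
   Context: All graphs are finite and simple. Linear time means time $\mathcal{O}(n+m)$, where $n$ and $m$ are the numbers of nodes and edges of the input graph. A cycle in $G$ is a sequence of nodes $v_1v_2\ldots v_kv_1$ ($k\ge3$), distinct except for the first and last, with consecutive nodes adjacent; an edge of $G$ with both ends in the cycle that is not an edge of the cycle is a chord. $G$ does not contain a cycle with a unique chord if no cycle of $G$ has exactly one chord. -}

module Defs where

open import Data.Bool using (if_then_else_)
open import Data.Fin using (Fin; toℕ)
open import Data.Fin.Properties using (_<?_)
open import Data.List using (List; []; _∷_; _++_; length; map; take; concat; filter; lookup; allFin; cartesianProduct)
open import Data.List.Membership.Propositional using (_∈_)
open import Data.List.Relation.Binary.Infix.Heterogeneous using (Infix)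
open import Data.List.Relation.Unary.Linked using (Linked)
open import Data.List.Relation.Unary.Unique.Propositional using (Unique)
open import Data.Nat using (ℕ; zero; suc; _+_; _*_; _∸_; _≤_; _<_; _≥_; _≡ᵇ_)
open import Data.Product using (∃-syntax; _×_; _,_; proj₁; proj₂)
open import Data.Sum using (_⊎_)
open import Function using (_⇔_)
open import Level using (0ℓ)
open import Relation.Binary using (Rel; Decidable; Symmetric; Irreflexive)
open import Relation.Binary.PropositionalEquality using (_≡_; _≢_)
open import Relation.Nullary using (¬_)
open import Relation.Nullary.Decidable using (_×-dec_)

record Graph : Set₁ where
  field
    order  : ℕ
    Adj    : Rel (Fin order) 0ℓ
    adj?   : Decidable Adj
    sym    : Symmetric Adj
    irrefl : Irreflexive _≡_ Adj

  Node : Set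
  Node = Fin order

  -- Every edge is listed once, its smaller end first.
  edges : List (Node × Node)
  edges = filter (λ e → (proj₁ e <? proj₂ e) ×-dec adj? (proj₁ e) (proj₂ e))
                 (cartesianProduct (allFin order) (allFin order))

  size : ℕ
  size = length edges

module _ (G : Graph) where
  open Graph G

  -- The cycle v₁v₂…vₖv₁ is given by v₁ and the list v₂…vₖ.
  closed : Node → List Node → List Node
  closed v vs = v ∷ vs ++ v ∷ []

  IsCycle : Node → List Node → Set
  IsCycle v vs = length (v ∷ vs) ≥ 3 × Unique (v ∷ vs) × Linked Adj (closed v vs)

  CycleEdge : Node → List Node → Node → Node → Set
  CycleEdge v vs x y =
    Infix _≡_ (x ∷ y ∷ []) (closed v vs) ⊎ Infix _≡_ (y ∷ x ∷ []) (closed v vs)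

  IsChord : Node → List Node → Node → Node → Set
  IsChord v vs x y =
    x ∈ v ∷ vs × y ∈ v ∷ vs × Adj x y × ¬ CycleEdge v vs x y

  SameEdge : Node → Node → Node → Node → Set
  SameEdge x y x′ y′ = (x ≡ x′ × y ≡ y′) ⊎ (x ≡ y′ × y ≡ x′)

  HasUniqueChord : Node → List Node → Set
  HasUniqueChord v vs =
    ∃[ x ] ∃[ y ] (IsChord v vs x y ×
                   (∀ x′ y′ → IsChord v vs x′ y′ → SameEdge x y x′ y′))

  NoCycleWithUniqueChord : Set
  NoCycleWithUniqueChord = ∀ v vs → IsCycle v vs → ¬ HasUniqueChord v vs

  -- Sets of nodes are lists without repetition, so that length is cardinality.
  IsClique : List Node → Set
  IsClique K = Unique K × (∀ {x y} → x ∈ K → y ∈ K → x ≢ y → Adj x y)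

  IsMaximumClique : List Node → Set
  IsMaximumClique K = IsClique K × (∀ L → IsClique L → length L ≤ length K)

  record AdjacencyLists : Set where
    field
      neighbours : Node → List Node
      unique     : ∀ v → Unique (neighbours v)
      adjacent   : ∀ {v x} → x ∈ neighbours v ⇔ Adj v x

-- Structured programs for a unit-cost RAM.  A program refers to finitely many
-- registers, named by numerals, and finitely many arrays, also named by
-- numerals.  An array may be indexed by the content of a register, but the
-- names of registers and arrays are fixed by the program text.  (A machine with
-- one memory can hold K arrays by keeping entry i of array a in cell K * i + a.)

data Expr : Set where
  lit  : ℕ → Expr
  reg  : ℕ → Expr
  _⊕_  : ℕ → ℕ → Expr
  _⊖_  : ℕ → ℕ → Expr
  _⟦_⟧ : ℕ → ℕ → Expr

data Test : Set where
  _≺_ _≈_ : ℕ → ℕ → Test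

infix  4 _≔_ _⟦_⟧≔_
infixr 3 _⨾_

data Program : Set where
  skip          : Program
  _≔_           : ℕ → Expr → Program
  _⟦_⟧≔_        : ℕ → ℕ → ℕ → Program
  _⨾_           : Program → Program → Program
  If_Then_Else_ : Test → Program → Program → Program
  While_Do_     : Test → Program → Program

record State : Set where
  constructor state
  field
    regs   : ℕ → ℕ
    arrays : ℕ → ℕ → ℕ

open State public

_[_↦_] : {A : Set} → (ℕ → A) → ℕ → A → (ℕ → A)
(f [ i ↦ a ]) j = if i ≡ᵇ j then a else f j

setReg : ℕ → ℕ → State → State
setReg x w σ = state (regs σ [ x ↦ w ]) (arrays σ)

setCell : ℕ → ℕ → ℕ → State → State
setCell a i w σ = state (regs σ) (arrays σ [ a ↦ arrays σ a [ i ↦ w ] ])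

eval : Expr → State → ℕ
eval (lit k)   σ = k
eval (reg x)   σ = regs σ x
eval (x ⊕ y)   σ = regs σ x + regs σ y
eval (x ⊖ y)   σ = regs σ x ∸ regs σ y
eval (a ⟦ x ⟧) σ = arrays σ a (regs σ x)

Holds : Test → State → Set
Holds (x ≺ y) σ = regs σ x < regs σ y
Holds (x ≈ y) σ = regs σ x ≡ regs σ y

-- W ⊢ P , σ ⇓ τ , t : on a machine whose words hold the numbers 0, …, W,
-- program P started in state σ halts in state τ after t steps.  A computation
-- in which a register overflows has no derivation.
infix 2 _⊢_,_⇓_,_

data _⊢_,_⇓_,_ (W : ℕ) : Program → State → State → ℕ → Set where
  skip   : ∀ {σ} → W ⊢ skip , σ ⇓ σ , 1
  assign : ∀ {x e σ} → eval e σ ≤ W →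
           W ⊢ x ≔ e , σ ⇓ setReg x (eval e σ) σ , 1
  store  : ∀ {a x y σ} →
           W ⊢ a ⟦ x ⟧≔ y , σ ⇓ setCell a (regs σ x) (regs σ y) σ , 1
  seq    : ∀ {P Q ρ σ τ s t} →
           W ⊢ P , ρ ⇓ σ , s → W ⊢ Q , σ ⇓ τ , t →
           W ⊢ P ⨾ Q , ρ ⇓ τ , s + t
  if-yes : ∀ {b P Q σ τ t} → Holds b σ → W ⊢ P , σ ⇓ τ , t →
           W ⊢ If b Then P Else Q , σ ⇓ τ , suc t
  if-no  : ∀ {b P Q σ τ t} → ¬ Holds b σ → W ⊢ Q , σ ⇓ τ , t →
           W ⊢ If b Then P Else Q , σ ⇓ τ , suc t
  again  : ∀ {b P ρ σ τ s t} → Holds b ρ →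
           W ⊢ P , ρ ⇓ σ , s → W ⊢ While b Do P , σ ⇓ τ , t →
           W ⊢ While b Do P , ρ ⇓ τ , suc (s + t)
  done   : ∀ {b P σ} → ¬ Holds b σ →
           W ⊢ While b Do P , σ ⇓ σ , 1

-- Entry i of a list, and 0 past its end.
entry : List ℕ → ℕ → ℕ
entry []       _       = 0
entry (w ∷ ws) zero    = w
entry (w ∷ ws) (suc i) = entry ws i

module _ {G : Graph} where
  open Graph G

  -- The nodes are 0, …, n - 1.  Register 0 holds n.  Array 1 holds the
  -- neighbour lists of nodes 0, …, n - 1 one after the other, and the list of
  -- v occupies the entries i with (array 0)[v] ≤ i < (array 0)[v + 1].
  -- From index n on, array 0 is constantly 2 m.  Everything else is 0.
  input : AdjacencyLists G → State
  input A = state regs₀ arrays₀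
    where
    lists : List (List ℕ)
    lists = map (λ v → map toℕ (AdjacencyLists.neighbours A v)) (allFin order)

    regs₀ : ℕ → ℕ
    regs₀ 0 = order
    regs₀ _ = 0

    arrays₀ : ℕ → ℕ → ℕ
    arrays₀ 0 v = length (concat (take v lists))
    arrays₀ 1 i = entry (concat lists) i
    arrays₀ _ _ = 0

  -- The number of nodes is in register 0, the nodes themselves in array 2.
  Outputs : State → List Node → Set
  Outputs τ K = regs τ 0 ≡ length K ×
                (∀ i → arrays τ 2 (toℕ i) ≡ toℕ (lookup K i))

-- On every graph G satisfying Pre, however its adjacency lists are ordered, P
-- halts within O(n + m) steps and outputs some K with Post G K.  The summand 1
-- only serves the graph without nodes.  Words have log₂ (n + m) + O(1) bits, so
-- large numbers cannot be used to do more than constant work in one step.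
LinearTimeAlgorithm : (Pre : Graph → Set) (Post : (G : Graph) → List (Graph.Node G) → Set) →
                      Program → Set₁
LinearTimeAlgorithm Pre Post P =
  ∃[ c ] ((G : Graph) → Pre G → (A : AdjacencyLists G) →
    let N = Graph.order G + Graph.size G + 1 in
    ∃[ τ ] ∃[ t ] ∃[ K ]
      ((c * N ⊢ P , input A ⇓ τ , t) × t ≤ c * N × Outputs {G} τ K × Post G K))

{-# OPTIONS --safe #-}

-- A triangle spans a unique maximal clique K, and every path that leaves K and returns
-- at another node of K can be shortened to one that closes, with an edge ab and a
-- further node of K, to a cycle with unique chord ab; so K is a block of G.  In a graph
-- search, when the first node r of K is taken from the stack, no other node of K can be
-- on the stack, since the search would have reached it by a path outside K.  Hence all
-- nodes of K except r get the parent r.  Conversely, a node together with its parent and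
-- its adjacent siblings is always a clique, since G contains no diamond.  The largest of
-- these n cliques is found by looking once more at every neighbour list.

module Submission where

open import Data.Empty using (⊥; ⊥-elim)
open import Data.Fin using (Fin; toℕ; zero; suc; fromℕ<)
open import Data.Fin.Properties using (_≟_; any?; toℕ-injective; toℕ<n; toℕ-fromℕ<)
open import Data.List using (List; []; _∷_; _++_; length; filter; lookup; map; concat; take; allFin; tabulate)
open import Data.List.Membership.Propositional using (_∈_; _∉_)
open import Data.List.Membership.Propositional.Properties using (∈-++⁺ˡ; ∈-++⁺ʳ; ∈-++⁻; ∈-filter⁺; ∈-filter⁻; ∈-∃++; ∈-length; ∈-map⁺; ∈-map⁻; ∈-allFin; ∈-cartesianProduct⁺)
import Data.List.Membership.DecPropositional as DecMembership
open import Data.List.Properties using (length-++; length-map; map-++; concat-++; ++-assoc; ++-identityʳ; ∷-injectiveʳ; length-tabulate; filter-accept; filter-reject)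
open import Data.List.Relation.Binary.Infix.Heterogeneous using (Infix; here; there; _ⁱ++_)
open import Data.List.Relation.Binary.Prefix.Heterogeneous using ([]; _∷_)
open import Data.List.Relation.Unary.All as All using (All; []; _∷_)
import Data.List.Relation.Unary.All.Properties as All
open import Data.List.Relation.Unary.AllPairs as AllPairs using (AllPairs; []; _∷_)
open import Data.List.Relation.Unary.Any as Any using (Any; here; there)
open import Data.List.Relation.Unary.Linked using (Linked; [-]; _∷_)
open import Data.List.Relation.Unary.Unique.Propositional using (Unique)
import Data.List.Relation.Unary.Unique.Propositional.Properties as Unique
open import Data.Nat using (ℕ; zero; suc; s≤s; z≤n; _≤_; _<_; _+_; _*_; _∸_)
open import Data.Nat.Induction using (Acc; acc; <-wellFounded)
open import Data.Nat.Properties as ℕ using (≤-trans; ≤-reflexive; +-suc; +-identityʳ; suc-injective; <-irrefl)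
open import Data.Nat.Solver using (module +-*-Solver)
open import Data.Product using (∃-syntax; _×_; _,_; proj₁; proj₂; swap)
open import Data.Product.Properties using (,-injectiveʳ)
open import Data.Sum using (_⊎_; inj₁; inj₂; [_,_]′)
open import Data.Unit using (⊤; tt)
open import Function using (_∘_; _⇔_; Equivalence)
open import Relation.Binary using (tri<; tri≈; tri>)
open import Relation.Binary.PropositionalEquality using (_≡_; _≢_; refl; subst; subst₂; trans; cong; cong₂; ≢-sym; module ≡-Reasoning)
import Relation.Binary.PropositionalEquality as ≡
open import Relation.Nullary using (¬_; Dec; yes; no)
open import Relation.Nullary.Decidable using (_×-dec_; _⊎-dec_; ¬?)
open import Defs

-- The only property of the search order that matters is that any two nodes waiting on the stack are
-- joined by a detour through taken nodes. Nodes are marked when pushed, so each enters the stack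
-- once, and scanning a taken node `v` keeps the property, since `v` reaches all waiting nodes
-- through taken ones. No shortest detour is ever chosen. A path into `K` is straightened node by
-- node from its end `e` in `K`, keeping it induced and keeping `e` the only neighbour in `K` of its
-- nodes; a first node that violated this would close the forbidden cycle. The program never learns
-- which triangles exist. It compares parent entries along a neighbour list. All roots share one
-- entry, so equal entries of neighbours mean siblings only because adjacent nodes are never both
-- roots. The same fact settles cliques of two nodes, for which no triangle is available.

infix-∈ˡ : ∀ {A : Set} {x y : A} {zs} → Infix _≡_ (x ∷ y ∷ []) zs → x ∈ zs
infix-∈ˡ (here (refl ∷ _)) = here refl
infix-∈ˡ (there p)         = there (infix-∈ˡ p)

infix-∈ʳ : ∀ {A : Set} {x y z : A} {zs} → Infix _≡_ (x ∷ y ∷ []) (z ∷ zs) → y ∈ zs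
infix-∈ʳ (here (_ ∷ refl ∷ _)) = here refl
infix-∈ʳ {zs = _ ∷ _} (there p) = there (infix-∈ʳ p)
infix-∈ʳ {zs = []} (there (here ()))

-- Cliques and detours

module Cliques (G : Graph) (chordless : NoCycleWithUniqueChord G) where
  open Graph G

  adj⇒≢ : ∀ {x y} → Adj x y → x ≢ y
  adj⇒≢ a e = irrefl e a

  -- Adjacency to the next node and to no later one makes `Induced` an induced path read from its
  -- front. Inequality is demanded along with nonadjacency, so that the nodes are distinct for free
  -- and the pair is the negation of `Touches`.
  Starts : Node → List Node → Set
  Starts x []       = ⊤
  Starts x (y ∷ ys) = Adj x y × All (λ z → x ≢ z × ¬ Adj x z) ys

  data Induced : List Node → Set where
    []  : Induced []
    _∷_ : ∀ {x xs} → Starts x xs → Induced xs → Induced (x ∷ xs)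

  starts⇒≢ : ∀ {x} xs → Starts x xs → All (x ≢_) xs
  starts⇒≢ []      _        = []
  starts⇒≢ (_ ∷ _) (a , ns) = adj⇒≢ a ∷ All.map proj₁ ns

  induced-unique : ∀ {xs} → Induced xs → Unique xs
  induced-unique []       = []
  induced-unique (s ∷ is) = starts⇒≢ _ s ∷ induced-unique is

  starts-infix : ∀ {x y} xs → Starts x xs → y ∈ xs → Adj x y →
                 Infix _≡_ (x ∷ y ∷ []) (x ∷ xs)
  starts-infix (_ ∷ _) _        (here refl) _ = here (refl ∷ refl ∷ [])
  starts-infix (_ ∷ _) (_ , ns) (there y∈)  a = ⊥-elim (proj₂ (All.lookup ns y∈) a)

  induced-infix : ∀ {xs x y} → Induced xs → x ∈ xs → y ∈ xs → Adj x y →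
                  Infix _≡_ (x ∷ y ∷ []) xs ⊎ Infix _≡_ (y ∷ x ∷ []) xs
  induced-infix (s ∷ is) (here refl) (here refl) a = ⊥-elim (adj⇒≢ a refl)
  induced-infix (s ∷ is) (here refl) (there y∈)  a = inj₁ (starts-infix _ s y∈ a)
  induced-infix (s ∷ is) (there x∈)  (here refl) a = inj₂ (starts-infix _ s x∈ (sym a))
  induced-infix (s ∷ is) (there x∈)  (there y∈)  a with induced-infix is x∈ y∈ a
  ... | inj₁ p = inj₁ (there p)
  ... | inj₂ p = inj₂ (there p)

  ends : ∀ {v b : Node} ps → b ∈ v ∷ ps ++ b ∷ []
  ends ps = there (∈-++⁺ʳ ps (here refl))

  last-infix : ∀ {b c : Node} xs → Infix _≡_ (b ∷ c ∷ []) ((xs ++ b ∷ []) ++ c ∷ [])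
  last-infix []       = here (refl ∷ refl ∷ [])
  last-infix (_ ∷ xs) = there (last-infix xs)

  linked-end : ∀ {b c} xs → Induced (xs ++ b ∷ []) → Adj b c →
               Linked Adj ((xs ++ b ∷ []) ++ c ∷ [])
  linked-end []           _               a = a ∷ [-]
  linked-end (_ ∷ [])     ((b , _) ∷ is)  a = b ∷ linked-end [] is a
  linked-end (_ ∷ y ∷ xs) ((b , _) ∷ is)  a = b ∷ linked-end (y ∷ xs) is a

  -- The cycle c a x ps b c has the unique chord ab.
  no-ear : ∀ {a b c x} ps → Adj a b → Adj c a → Adj c b → Adj a x →
           Induced (x ∷ ps ++ b ∷ []) →
           All (λ p → a ≢ p × ¬ Adj a p) ps →
           All (λ p → c ≢ p × ¬ Adj c p) (x ∷ ps) → ⊥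
  no-ear {a} {b} {c} {x} ps a∼b c∼a c∼b a∼x is@(st ∷ _) a≁ps c≁xps =
    chordless c (a ∷ xpsb) (s≤s (s≤s (s≤s z≤n)) , unique , linked)
      (a , b , (there (here refl) , there (ends (x ∷ ps)) , a∼b , no-edge) , only)
    where
    xpsb = x ∷ ps ++ b ∷ []
    rest = (ps ++ b ∷ []) ++ c ∷ []

    a≢ : All (a ≢_) xpsb
    a≢ = adj⇒≢ a∼x ∷ All.++⁺ (All.map proj₁ a≁ps) (adj⇒≢ a∼b ∷ [])

    unique : Unique (c ∷ a ∷ xpsb)
    unique = (adj⇒≢ c∼a ∷ All.++⁺ (All.map proj₁ c≁xps) (adj⇒≢ c∼b ∷ []))
             ∷ a≢ ∷ induced-unique is

    linked : Linked Adj (closed G c (a ∷ xpsb))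
    linked = c∼a ∷ a∼x ∷ linked-end (x ∷ ps) is (sym c∼b)

    a∉ : a ∉ x ∷ rest
    a∉ a∈ with ∈-++⁻ xpsb a∈
    ... | inj₁ p           = All.lookup a≢ p refl
    ... | inj₂ (here refl) = adj⇒≢ c∼a refl

    x≢b : x ≢ b
    x≢b = All.lookup (starts⇒≢ _ st) (∈-++⁺ʳ ps (here refl))

    no-edge : ¬ CycleEdge G c (a ∷ xpsb) a b
    no-edge (inj₁ (here (refl ∷ _)))             = adj⇒≢ c∼a refl
    no-edge (inj₁ (there (here (_ ∷ refl ∷ _)))) = x≢b refl
    no-edge (inj₁ (there (there p)))             = a∉ (infix-∈ˡ p)
    no-edge (inj₂ (here (refl ∷ _)))             = adj⇒≢ c∼b refl
    no-edge (inj₂ (there (here (refl ∷ _))))     = adj⇒≢ a∼b refl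
    no-edge (inj₂ (there (there p)))             = a∉ (there (infix-∈ʳ p))

    from-a : ∀ {y} → y ∈ xpsb → Adj a y → Infix _≡_ (a ∷ y ∷ []) (a ∷ xpsb) ⊎ y ≡ b
    from-a (here refl) _ = inj₁ (here (refl ∷ refl ∷ []))
    from-a (there y∈)  e with ∈-++⁻ ps y∈
    ... | inj₁ p           = ⊥-elim (proj₂ (All.lookup a≁ps p) e)
    ... | inj₂ (here refl) = inj₂ refl

    from-c : ∀ {y} → y ∈ a ∷ xpsb → Adj c y → y ≡ a ⊎ y ≡ b
    from-c (here refl) _ = inj₁ refl
    from-c (there y∈)  e with ∈-++⁻ (x ∷ ps) y∈
    ... | inj₁ p           = ⊥-elim (proj₂ (All.lookup c≁xps p) e)
    ... | inj₂ (here refl) = inj₂ refl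

    cycle-edge-c : ∀ {y} → y ≡ a ⊎ y ≡ b → CycleEdge G c (a ∷ xpsb) c y
    cycle-edge-c (inj₁ refl) = inj₁ (here (refl ∷ refl ∷ []))
    cycle-edge-c (inj₂ refl) = inj₂ (there (there (last-infix (x ∷ ps))))

    swap-edge : ∀ {y z} → CycleEdge G c (a ∷ xpsb) y z → CycleEdge G c (a ∷ xpsb) z y
    swap-edge (inj₁ p) = inj₂ p
    swap-edge (inj₂ p) = inj₁ p

    widen : ∀ {y z} → Infix _≡_ (y ∷ z ∷ []) (a ∷ xpsb) →
            Infix _≡_ (y ∷ z ∷ []) (closed G c (a ∷ xpsb))
    widen p = there (p ⁱ++ (c ∷ []))

    -- Every neighbour of `c` on the cycle is next to it, `a` sees only `c`, `x` and `b`, and the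
    -- rest is an induced path; this leaves `a` and `b`.
    only : ∀ y z → IsChord G c (a ∷ xpsb) y z → SameEdge G a b y z
    only y z (here refl , here refl , e , _) = ⊥-elim (adj⇒≢ e refl)
    only y z (here refl , there z∈ , e , n)  = ⊥-elim (n (cycle-edge-c (from-c z∈ e)))
    only y z (there y∈ , here refl , e , n)  =
      ⊥-elim (n (swap-edge (cycle-edge-c (from-c y∈ (sym e)))))
    only y z (there (here refl) , there (here refl) , e , _) = ⊥-elim (adj⇒≢ e refl)
    only y z (there (here refl) , there (there z∈) , e , n) with from-a z∈ e
    ... | inj₁ p    = ⊥-elim (n (inj₁ (widen p)))
    ... | inj₂ refl = inj₁ (refl , refl)
    only y z (there (there y∈) , there (here refl) , e , n) with from-a y∈ (sym e)
    ... | inj₁ p    = ⊥-elim (n (inj₂ (widen p)))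
    ... | inj₂ refl = inj₂ (refl , refl)
    only y z (there (there y∈) , there (there z∈) , e , n) with induced-infix is y∈ z∈ e
    ... | inj₁ p = ⊥-elim (n (inj₁ (widen (there p))))
    ... | inj₂ p = ⊥-elim (n (inj₂ (widen (there p))))

  -- The ear with empty `ps`: without an edge from `x` to `y`, the four-cycle through `x`, `a`, `y`,
  -- `b` has the unique chord from `a` to `b`.
  diamond-free : ∀ {a b x y} → Adj a b → Adj a x → Adj b x → Adj a y → Adj b y →
                 x ≢ y → Adj x y
  diamond-free {x = x} {y} a∼b a∼x b∼x a∼y b∼y x≢y with adj? x y
  ... | yes x∼y = x∼y
  ... | no  x≁y = ⊥-elim (no-ear [] a∼b (sym a∼x) (sym b∼x) a∼y
                           ((sym b∼y , []) ∷ tt ∷ []) [] ((x≢y , x≁y) ∷ []))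

  -- If ab lies in a triangle, this is the maximal clique through ab.
  Span : Node → Node → Node → Set
  Span a b x = x ≡ a ⊎ x ≡ b ⊎ (Adj a x × Adj b x)

  span? : ∀ a b x → Dec (Span a b x)
  span? a b x = (x ≟ a) ⊎-dec (x ≟ b) ⊎-dec (adj? a x ×-dec adj? b x)

  module Triangle {a b c} (a∼b : Adj a b) (a∼c : Adj a c) (b∼c : Adj b c) where

    K : Node → Set
    K = Span a b

    clique : ∀ {x y} → K x → K y → x ≢ y → Adj x y
    clique (inj₁ refl)        (inj₁ refl)        n = ⊥-elim (n refl)
    clique (inj₁ refl)        (inj₂ (inj₁ refl)) n = a∼b
    clique (inj₁ refl)        (inj₂ (inj₂ (p , q))) n = p
    clique (inj₂ (inj₁ refl)) (inj₁ refl)        n = sym a∼b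
    clique (inj₂ (inj₁ refl)) (inj₂ (inj₁ refl)) n = ⊥-elim (n refl)
    clique (inj₂ (inj₁ refl)) (inj₂ (inj₂ (p , q))) n = q
    clique (inj₂ (inj₂ (p , q))) (inj₁ refl)        n = sym p
    clique (inj₂ (inj₂ (p , q))) (inj₂ (inj₁ refl)) n = sym q
    clique (inj₂ (inj₂ (p , q))) (inj₂ (inj₂ (r , s))) n = diamond-free a∼b p q r s n

    -- Both `z` and `p` are common neighbours of the edge from `x` to `y`, so the absence of
    -- diamonds joins them. Applied to `a` and `b`, this puts `p` into the span, which gives
    -- `maximal`.
    absorbs : ∀ {p x y z} → ¬ K p → K x → K y → x ≢ y → Adj p x → Adj p y → K z → Adj z p
    absorbs {p} {x} {y} {z} p∉ kx ky x≢y p∼x p∼y kz with z ≟ x | z ≟ y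
    ... | yes refl | _        = sym p∼x
    ... | no _     | yes refl = sym p∼y
    ... | no z≢x   | no z≢y   =
      diamond-free (clique kx ky x≢y) (clique kx kz (≢-sym z≢x)) (clique ky kz (≢-sym z≢y))
        (sym p∼x) (sym p∼y) (λ { refl → p∉ kz })

    maximal : ∀ {p x y} → ¬ K p → K x → K y → x ≢ y → Adj p x → Adj p y → ⊥
    maximal p∉ kx ky x≢y p∼x p∼y =
      p∉ (inj₂ (inj₂ (absorbs p∉ kx ky x≢y p∼x p∼y (inj₁ refl) ,
                      absorbs p∉ kx ky x≢y p∼x p∼y (inj₂ (inj₁ refl)))))

    third : ∀ x y → ∃[ z ] (K z × z ≢ x × z ≢ y)
    third x y with a ≟ x | a ≟ y
    ... | no p | no q = a , inj₁ refl , p , q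
    ... | yes refl | _ with b ≟ y
    ...   | no q = b , inj₂ (inj₁ refl) , adj⇒≢ (sym a∼b) , q
    ...   | yes refl = c , inj₂ (inj₂ (a∼c , b∼c)) , adj⇒≢ (sym a∼c) , adj⇒≢ (sym b∼c)
    third x y | no p | yes refl with b ≟ x
    ...   | no q = b , inj₂ (inj₁ refl) , q , adj⇒≢ (sym a∼b)
    ...   | yes refl = c , inj₂ (inj₂ (a∼c , b∼c)) , adj⇒≢ (sym b∼c) , adj⇒≢ (sym a∼c)

  -- Paths and detours through a set of nodes

  data Path (S : Node → Set) : Node → Node → Set where
    edge : ∀ {x y} → Adj x y → Path S x y
    step : ∀ {x y z} → Adj x y → S y → Path S y z → Path S x z

  -- At least one inner node is required, since a mere edge between two nodes of a clique
  -- contradicts nothing.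
  Detour : (Node → Set) → Node → Node → Set
  Detour S x z = ∃[ y ] (Adj x y × S y × Path S y z)

  path-mono : ∀ {S T : Node → Set} → (∀ {x} → S x → T x) → ∀ {x y} → Path S x y → Path T x y
  path-mono f (edge a)     = edge a
  path-mono f (step a s p) = step a (f s) (path-mono f p)

  detour-mono : ∀ {S T : Node → Set} → (∀ {x} → S x → T x) → ∀ {x y} → Detour S x y → Detour T x y
  detour-mono f (y , a , s , p) = y , a , f s , path-mono f p

  detour⇒path : ∀ {S x y} → Detour S x y → Path S x y
  detour⇒path (_ , a , s , p) = step a s p

  Touches : Node → Node → Set
  Touches x y = x ≡ y ⊎ Adj x y

  touches? : ∀ x y → Dec (Touches x y)
  touches? x y = (x ≟ y) ⊎-dec adj? x y

  -- Jump from `x` to the last node of the path that it touches and drop everything before. If that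
  -- node is `x` itself, the path from there on is already the answer; `x ≢ b` keeps this from
  -- happening at the end.
  attach : ∀ {b x} {P : Node → Set} ps → x ≢ b → Induced (ps ++ b ∷ []) → All P ps →
           Any (Touches x) (ps ++ b ∷ []) →
           ∃[ qs ] (Induced (x ∷ qs ++ b ∷ []) × All P qs)
  attach []       x≢b is _ (here (inj₁ e)) = ⊥-elim (x≢b e)
  attach []       x≢b is _ (here (inj₂ a)) = [] , (a , []) ∷ is , []
  attach {b} {x} (y ∷ ps) x≢b (s ∷ is) (h ∷ hs) t with Any.any? (touches? x) (ps ++ b ∷ [])
  ... | yes t′ = attach ps x≢b is hs t′
  ... | no ¬t with t
  ...   | there t′         = ⊥-elim (¬t t′)
  ...   | here (inj₁ refl) = ps , s ∷ is , hs
  ...   | here (inj₂ a)    =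
    y ∷ ps , (a , All.map (λ n → n ∘ inj₁ , n ∘ inj₂) (All.¬Any⇒All¬ _ ¬t)) ∷ s ∷ is , h ∷ hs

  -- A shortest detour around the maximal clique K together with a third node of
  -- K would be a cycle with a unique chord.
  module _ {a b c} (a∼b : Adj a b) (a∼c : Adj a c) (b∼c : Adj b c) where
    open Triangle a∼b a∼c b∼c

    private
      -- Exactly what `no-ear` asks of inner nodes, for every choice of two nodes of `K` other than
      -- `e` as `a` and `c`.
      Loose : Node → Node → Set
      Loose e p = ¬ K p × (∀ {k} → K k → Adj p k → k ≡ e)

      -- Induction from the end `e`: the rest of the path is already straight and loose, `attach`
      -- shortens the link from `z` to it, and `loosen′` then shows that `z` is loose as well.
      loosen : ∀ {e z} → K e → ¬ K z → Path (¬_ ∘ K) z e →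
               ∃[ ps ] (Induced (z ∷ ps ++ e ∷ []) × All (Loose e) (z ∷ ps))
      -- If `z` had a neighbour `k` in `K` other than `e`, take a third node `d` of `K`. By
      -- `maximal`, `z` is not adjacent to `d`, so the cycle through `d`, `k`, `z`, `ps`, `e` has
      -- only the chord from `k` to `e`.
      loosen′ : ∀ {e z ps} → K e → ¬ K z → Induced (z ∷ ps ++ e ∷ []) → All (Loose e) ps →
                Loose e z
      loosen′ {e} {z} {ps} ke z∉ is hs = z∉ , only
        where
        only : ∀ {k} → K k → Adj z k → k ≡ e
        only {k} kk z∼k with k ≟ e
        ... | yes p = p
        ... | no k≢e with third k e
        ...   | d , kd , d≢k , d≢e = ⊥-elim
          (no-ear ps (clique kk ke k≢e) (clique kd kk d≢k) (clique kd ke d≢e) (sym z∼k) is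
            (All.map (away k kk k≢e) hs)
            ((( λ { refl → z∉ kd }) , λ d∼z → maximal z∉ kk kd (≢-sym d≢k) z∼k (sym d∼z))
             ∷ All.map (away d kd d≢e) hs))
          where
          away : ∀ k → K k → k ≢ e → ∀ {p} → Loose e p → k ≢ p × ¬ Adj k p
          away k kk k≢e (p∉ , o) = (λ { refl → p∉ kk }) , λ a → k≢e (o kk (sym a))
      loosen ke z∉ (edge z∼e) =
        [] , (z∼e , []) ∷ tt ∷ [] , loosen′ ke z∉ ((z∼e , []) ∷ tt ∷ []) [] ∷ []
      loosen {e} {z} ke z∉ (step {y = y} z∼y y∉ p) with loosen ke y∉ p
      ... | qs , is , hs with attach (y ∷ qs) (λ { refl → z∉ ke }) is hs (here (inj₂ z∼y))
      ...   | ps , is′ , hs′ = ps , is′ , loosen′ ke z∉ is′ hs′ ∷ hs′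

    no-detour : ∀ {x e} → K x → K e → x ≢ e → Detour (¬_ ∘ K) x e → ⊥
    no-detour kx ke x≢e (y , x∼y , y∉ , p) with loosen ke y∉ p
    ... | _ , _ , (_ , o) ∷ _ = x≢e (o kx (sym x∼y))

unique-⊆⇒length≤ : ∀ {A : Set} {xs ys : List A} → Unique xs → (∀ {x} → x ∈ xs → x ∈ ys) →
                   length xs ≤ length ys
unique-⊆⇒length≤ {xs = []} _ _ = z≤n
unique-⊆⇒length≤ {xs = x ∷ xs} (x≢ ∷ u) sub with ∈-∃++ (sub (here refl))
... | as , bs , refl = ≤-trans (s≤s (unique-⊆⇒length≤ u sub′)) (≤-reflexive len)
  where
  sub′ : ∀ {y} → y ∈ xs → y ∈ as ++ bs
  sub′ y∈ with ∈-++⁻ as (sub (there y∈))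
  ... | inj₁ p           = ∈-++⁺ˡ p
  ... | inj₂ (here refl) = ⊥-elim (All.lookup x≢ y∈ refl)
  ... | inj₂ (there p)   = ∈-++⁺ʳ as p
  len : suc (length (as ++ bs)) ≡ length (as ++ x ∷ bs)
  len = trans (cong suc (length-++ as)) (trans (≡.sym (+-suc _ _)) (≡.sym (length-++ as)))

-- Graph search

module Search (G : Graph) (chordless : NoCycleWithUniqueChord G) where
  open Graph G
  open Cliques G chordless
  open DecMembership (_≟_ {order}) using (_∈?_)

  -- Parent entries `r + 1` use the values 1 to n and 0 means unmarked, so n + 1 is the first free
  -- value.
  rootMark : ℕ
  rootMark = suc order

  rootMark≢ : ∀ (x : Node) → suc (toℕ x) ≢ rootMark
  rootMark≢ x e = <-irrefl (suc-injective e) (toℕ<n x)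

  Parents : (Node → ℕ) → Set
  Parents par = ∀ x → par x ≡ 0 ⊎ par x ≡ rootMark ⊎ ∃[ r ] (par x ≡ suc (toℕ r) × Adj r x)

  -- The second alternative is the interim state during the scan of the centre `r`: a node of the
  -- clique may still be unmarked if it is yet to come in the list of `r`. Once the list is used up,
  -- all of them are children of `r`.
  Star : (Node → ℕ) → Node → List Node → Node → Node → Set
  Star par v ns a b =
    ∃[ r ] (Span a b r × (∀ {x} → Span a b x → x ≢ r →
                          par x ≡ suc (toℕ r) ⊎ (par x ≡ 0 × r ≡ v × x ∈ ns)))

  -- R: the nodes never taken from the stack; Q: the stack; v: the node taken
  -- last; ns: the neighbours of v still to be looked at; par x: 0 if x was never on
  -- the stack, r + 1 if x was found from r, rootMark if the search restarted at x.
  record Invariant (par : Node → ℕ) (R Q : List Node) (v : Node) (ns : List Node) : Set where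
    field
      parents  : Parents par
      roots    : ∀ {x y} → par x ≡ rootMark → par y ≡ rootMark → ¬ Adj x y
      explored : ∀ {x y} → x ∉ R → Adj x y → par y ≢ 0 ⊎ (x ≡ v × y ∈ ns)
      unseen   : ∀ {x} → par x ≡ 0 → x ∈ R
      onStack  : ∀ {x} → x ∈ Q → x ∈ R × par x ≢ 0
      waiting  : ∀ {x} → x ∈ R → par x ≢ 0 → x ∈ Q
      distinct : Unique Q
      detours  : AllPairs (Detour (_∉ R)) Q
      scanning : ∀ {w} → w ∈ ns → v ∉ R × Adj v w × All (Path (_∉ R) v) Q
      stars    : ∀ {a b c} → Adj a b → Adj a c → Adj b c →
                 ∀ {x} → Span a b x → x ∉ R → Star par v ns a b

  initially : ∀ {par : Node → ℕ} {R v} → (∀ x → par x ≡ 0) → (∀ x → x ∈ R) →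
              Invariant par R [] v []
  initially p≡0 ∈R = record
    { parents  = λ x → inj₁ (p≡0 x)
    ; roots    = λ {x} e → ⊥-elim (ℕ.0≢1+n (trans (≡.sym (p≡0 x)) e))
    ; explored = λ {x} x∉ → ⊥-elim (x∉ (∈R x))
    ; unseen   = λ {x} _ → ∈R x
    ; onStack  = λ ()
    ; waiting  = λ {x} _ n → ⊥-elim (n (p≡0 x))
    ; distinct = []
    ; detours  = []
    ; scanning = λ ()
    ; stars    = λ _ _ _ {x} _ x∉ → ⊥-elim (x∉ (∈R x))
    }

  module Step {par R Q v ns} (inv : Invariant par R Q v ns) where
    open Invariant inv

    skipSeen : ∀ {w ms} → ns ≡ w ∷ ms → par w ≢ 0 → Invariant par R Q v ms
    skipSeen {w} {ms} refl seen = record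
      { parents  = parents
      ; roots    = roots
      ; explored = explored′
      ; unseen   = unseen
      ; onStack  = onStack
      ; waiting  = waiting
      ; distinct = distinct
      ; detours  = detours
      ; scanning = λ w∈ → scanning (there w∈)
      ; stars    = λ a∼b a∼c b∼c k x∉ → star (stars a∼b a∼c b∼c k x∉)
      }
      where
      explored′ : ∀ {x y} → x ∉ R → Adj x y → par y ≢ 0 ⊎ (x ≡ v × y ∈ ms)
      explored′ x∉ a with explored x∉ a
      ... | inj₁ p                  = inj₁ p
      ... | inj₂ (_ , here refl)    = inj₁ seen
      ... | inj₂ (x≡v , there y∈)   = inj₂ (x≡v , y∈)
      star : ∀ {a b} → Star par v (w ∷ ms) a b → Star par v ms a b
      star (r , kr , f) = r , kr , λ kx x≢r → g (f kx x≢r)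
        where
        g : ∀ {x} → par x ≡ suc (toℕ r) ⊎ (par x ≡ 0 × r ≡ v × x ∈ w ∷ ms) →
            par x ≡ suc (toℕ r) ⊎ (par x ≡ 0 × r ≡ v × x ∈ ms)
        g (inj₁ p)                        = inj₁ p
        g (inj₂ (p , _ , here refl))      = ⊥-elim (seen p)
        g (inj₂ (p , q , there x∈))       = inj₂ (p , q , x∈)

    -- Common to both ways of marking a node, as a child of `v` or as a root; only the value of the
    -- mark differs.
    module Mark {w m} (par′ : Node → ℕ) (unmarked : par w ≡ 0) (marked : par′ w ≡ suc m)
                (same : ∀ {x} → x ≢ w → par′ x ≡ par x) where

      marked≢0 : par′ w ≢ 0
      marked≢0 e = ℕ.0≢1+n (trans (≡.sym e) marked)

      still≢0 : ∀ {x} → par x ≢ 0 → par′ x ≢ 0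
      still≢0 n e = n (trans (≡.sym (same λ { refl → n unmarked })) e)

      was≡0 : ∀ {x} → par′ x ≡ 0 → par x ≡ 0
      was≡0 {x} e with x ≟ w
      ... | yes refl = unmarked
      ... | no x≢w   = trans (≡.sym (same x≢w)) e

      still : ∀ {x k} → par x ≡ suc k → par′ x ≡ suc k
      still e = trans (same λ { refl → ℕ.0≢1+n (trans (≡.sym unmarked) e) }) e

      onStack′ : ∀ {x} → x ∈ w ∷ Q → x ∈ R × par′ x ≢ 0
      onStack′ (here refl) = unseen unmarked , marked≢0
      onStack′ (there x∈)  = proj₁ (onStack x∈) , still≢0 (proj₂ (onStack x∈))

      waiting′ : ∀ {x} → x ∈ R → par′ x ≢ 0 → x ∈ w ∷ Q
      waiting′ {x} x∈ n with x ≟ w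
      ... | yes refl = here refl
      ... | no x≢w   = there (waiting x∈ λ e → n (trans (same x≢w) e))

      distinct′ : Unique (w ∷ Q)
      distinct′ = All.tabulate (λ { x∈ refl → proj₂ (onStack x∈) unmarked }) ∷ distinct

    discover : ∀ {w ms par′} → ns ≡ w ∷ ms → par w ≡ 0 → par′ w ≡ suc (toℕ v) →
               (∀ {x} → x ≢ w → par′ x ≡ par x) → Invariant par′ R (w ∷ Q) v ms
    discover {w} {ms} {par′} refl unmarked marked same = record
      { parents  = parents′
      ; roots    = λ p q → roots (wasRoot p) (wasRoot q)
      ; explored = explored′
      ; unseen   = unseen ∘ was≡0
      ; onStack  = onStack′
      ; waiting  = waiting′
      ; distinct = distinct′
      -- From `w` back to the taken node `v`, then along a path of `v`, every older node of the
      -- stack is reached.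
      ; detours  = All.map (λ p → v , sym v∼w , v∉ , p) paths ∷ detours
      ; scanning = λ w∈ → v∉ , proj₁ (proj₂ (scanning (there w∈))) , edge v∼w ∷ paths
      ; stars    = λ a∼b a∼c b∼c k x∉ → star (stars a∼b a∼c b∼c k x∉)
      }
      where
      open Mark par′ unmarked marked same
      v∉ = proj₁ (scanning (here refl))
      v∼w = proj₁ (proj₂ (scanning (here refl)))
      paths = proj₂ (proj₂ (scanning (here refl)))

      parents′ : Parents par′
      parents′ x with x ≟ w
      ... | yes refl = inj₂ (inj₂ (v , marked , v∼w))
      ... | no x≢w rewrite same x≢w = parents x

      wasRoot : ∀ {x} → par′ x ≡ rootMark → par x ≡ rootMark
      wasRoot {x} e with x ≟ w
      ... | yes refl = ⊥-elim (rootMark≢ v (trans (≡.sym marked) e))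
      ... | no x≢w   = trans (≡.sym (same x≢w)) e

      explored′ : ∀ {x y} → x ∉ R → Adj x y → par′ y ≢ 0 ⊎ (x ≡ v × y ∈ ms)
      explored′ x∉ a with explored x∉ a
      ... | inj₁ p                = inj₁ (still≢0 p)
      ... | inj₂ (_ , here refl)  = inj₁ marked≢0
      ... | inj₂ (x≡v , there y∈) = inj₂ (x≡v , y∈)

      star : ∀ {a b} → Star par v (w ∷ ms) a b → Star par′ v ms a b
      star (r , kr , f) = r , kr , λ kx x≢r → g (f kx x≢r)
        where
        g : ∀ {x} → par x ≡ suc (toℕ r) ⊎ (par x ≡ 0 × r ≡ v × x ∈ w ∷ ms) →
            par′ x ≡ suc (toℕ r) ⊎ (par′ x ≡ 0 × r ≡ v × x ∈ ms)
        g (inj₁ p)                      = inj₁ (still p)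
        g (inj₂ (_ , refl , here refl)) = inj₁ marked
        g {x} (inj₂ (p , q , there x∈)) with x ≟ w
        ... | yes refl = inj₁ (trans marked (cong (suc ∘ toℕ) (≡.sym q)))
        ... | no x≢w   = inj₂ (trans (same x≢w) p , q , x∈)

    -- With an empty stack every marked node has been taken, so its neighbours are marked too; the
    -- unmarked `s` is therefore adjacent to no earlier root. The old `v` stays as a placeholder
    -- with an empty list.
    restart : ∀ {s par′} → Q ≡ [] → ns ≡ [] → par s ≡ 0 → par′ s ≡ rootMark →
              (∀ {x} → x ≢ s → par′ x ≡ par x) → Invariant par′ R (s ∷ []) v []
    restart {s} {par′} refl refl unmarked marked same = record
      { parents  = parents′
      ; roots    = roots′
      ; explored = λ x∉ a → inj₁ (still≢0 (seen x∉ a))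
      ; unseen   = unseen ∘ was≡0
      ; onStack  = onStack′
      ; waiting  = waiting′
      ; distinct = distinct′
      ; detours  = [] ∷ []
      ; scanning = λ ()
      ; stars    = λ a∼b a∼c b∼c k x∉ → star (stars a∼b a∼c b∼c k x∉)
      }
      where
      open Mark par′ unmarked marked same

      seen : ∀ {x y} → x ∉ R → Adj x y → par y ≢ 0
      seen x∉ a with explored x∉ a
      ... | inj₁ p = p

      parents′ : Parents par′
      parents′ x with x ≟ s
      ... | yes refl = inj₂ (inj₁ marked)
      ... | no x≢s rewrite same x≢s = parents x

      popped : ∀ {x} → par x ≢ 0 → x ∉ R
      popped n x∈ with waiting x∈ n
      ... | ()

      old : ∀ {x} → x ≢ s → par′ x ≡ rootMark → par x ≡ rootMark
      old x≢s e = trans (≡.sym (same x≢s)) e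

      root≢0 : ∀ {x} → par x ≡ rootMark → par x ≢ 0
      root≢0 e e′ = ℕ.1+n≢0 (trans (≡.sym e) e′)

      roots′ : ∀ {x y} → par′ x ≡ rootMark → par′ y ≡ rootMark → ¬ Adj x y
      roots′ {x} {y} p q a with x ≟ s | y ≟ s
      ... | yes refl | yes refl = adj⇒≢ a refl
      ... | yes refl | no y≢s   = seen (popped (root≢0 (old y≢s q))) (sym a) unmarked
      ... | no x≢s   | yes refl = seen (popped (root≢0 (old x≢s p))) a unmarked
      ... | no x≢s   | no y≢s   = roots (old x≢s p) (old y≢s q) a

      star : ∀ {a b} → Star par v [] a b → Star par′ v [] a b
      star (r , kr , f) = r , kr , λ kx x≢r → g (f kx x≢r)
        where
        g : ∀ {x} → par x ≡ suc (toℕ r) ⊎ (par x ≡ 0 × r ≡ v × x ∈ []) →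
            par′ x ≡ suc (toℕ r) ⊎ (par′ x ≡ 0 × r ≡ v × x ∈ [])
        g (inj₁ p) = inj₁ (still p)

  _without_ : List Node → Node → List Node
  R without v = filter (λ x → ¬? (x ≟ v)) R

  -- The one step of the search that uses the structure of the graph. The list of `u` is used up, so
  -- all neighbours of taken nodes are marked. The detours from the top of the stack to the nodes
  -- below become the paths that `scanning` needs for the new `v`.
  pop : ∀ {par R Q u v ns} → Invariant par R (v ∷ Q) u [] → (∀ {x} → x ∈ ns ⇔ Adj v x) →
        Invariant par (R without v) Q v ns
  pop {par} {R} {Q} {u} {v} {ns} inv isAdj = record
    { parents  = parents
    ; roots    = roots
    ; explored = explored′
    ; unseen   = λ e → keep (unseen e) (λ { refl → proj₂ (onStack (here refl)) e })
    ; onStack  = λ x∈ → keep (proj₁ (onStack (there x∈))) (λ { refl → v∉Q x∈ }) ,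
                         proj₂ (onStack (there x∈))
    ; waiting  = waiting′
    ; distinct = AllPairs.tail distinct
    ; detours  = AllPairs.map (detour-mono more) (AllPairs.tail detours)
    ; scanning = λ w∈ → v∉ , Equivalence.to isAdj w∈ ,
                         All.map (λ d → detour⇒path (detour-mono more d)) (AllPairs.head detours)
    ; stars    = stars′
    }
    where
    open Invariant inv
    keep : ∀ {x} → x ∈ R → x ≢ v → x ∈ R without v
    keep = ∈-filter⁺ (λ x → ¬? (x ≟ v))
    kept : ∀ {x} → x ∈ R without v → x ∈ R × x ≢ v
    kept = ∈-filter⁻ (λ x → ¬? (x ≟ v))
    more : ∀ {x} → x ∉ R → x ∉ R without v
    more n x∈ = n (proj₁ (kept x∈))
    v∉ : v ∉ R without v
    v∉ v∈ = proj₂ (kept v∈) refl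
    v∉Q : v ∉ Q
    v∉Q v∈ = All.lookup (AllPairs.head distinct) v∈ refl

    before : ∀ {x} → x ∉ R without v → x ≢ v → x ∉ R
    before n x≢v x∈ = n (keep x∈ x≢v)

    seen : ∀ {x y} → x ∉ R → Adj x y → par y ≢ 0
    seen x∉ a with explored x∉ a
    ... | inj₁ p = p

    explored′ : ∀ {x y} → x ∉ R without v → Adj x y → par y ≢ 0 ⊎ (x ≡ v × y ∈ ns)
    explored′ {x} x∉ a with x ≟ v
    ... | yes refl = inj₂ (refl , Equivalence.from isAdj a)
    ... | no x≢v   = inj₁ (seen (before x∉ x≢v) a)

    waiting′ : ∀ {x} → x ∈ R without v → par x ≢ 0 → x ∈ Q
    waiting′ x∈ n with waiting (proj₁ (kept x∈)) n
    ... | here refl = ⊥-elim (v∉ x∈)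
    ... | there x∈Q = x∈Q

    stars′ : ∀ {a b c} → Adj a b → Adj a c → Adj b c →
             ∀ {x} → Span a b x → x ∉ R without v → Star par v ns a b
    -- If a node of the clique was taken earlier, its star is complete, because no list is being
    -- scanned. Otherwise `v` is the first one and becomes the centre.
    stars′ {a} {b} a∼b a∼c b∼c {x} kx x∉ with any? (λ y → span? a b y ×-dec ¬? (y ∈? R))
    ... | yes (y , ky , y∉) = let r , kr , f = stars a∼b a∼c b∼c ky y∉ in
                              r , kr , λ kz z≢r → inj₁ (old (f kz z≢r))
      where
      old : ∀ {z r} → par z ≡ suc (toℕ r) ⊎ (par z ≡ 0 × r ≡ u × z ∈ []) → par z ≡ suc (toℕ r)
      old (inj₁ p) = p
    ... | no none with x ≟ v
    ...   | no x≢v   = ⊥-elim (none (x , kx , before x∉ x≢v))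
    ...   | yes refl = v , kx , first
      where
      open Triangle a∼b a∼c b∼c using (clique)
      first : ∀ {z} → Span a b z → z ≢ v →
              par z ≡ suc (toℕ v) ⊎ (par z ≡ 0 × v ≡ v × z ∈ ns)
      first {z} kz z≢v with par z ℕ.≟ 0
      ... | yes p = inj₂ (p , refl , Equivalence.from isAdj (clique kx kz (≢-sym z≢v)))
      ... | no n with z ∈? R
      ...   | no z∉ = ⊥-elim (none (z , kz , z∉))
      ...   | yes z∈ with waiting z∈ n
      ...     | here z≡v  = ⊥-elim (z≢v z≡v)
      -- No node of the clique was taken before `v`, so the detour from `v` to `z` through taken
      -- nodes avoids the clique.
      ...     | there z∈Q = ⊥-elim (no-detour a∼b a∼c b∼c kx kz (≢-sym z≢v)
        (detour-mono (λ y∉ ky → none (_ , ky , y∉))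
          (All.lookup (AllPairs.head detours) z∈Q)))

  record Tree (par : Node → ℕ) : Set where
    field
      parent : ∀ x → par x ≡ rootMark ⊎ ∃[ r ] (par x ≡ suc (toℕ r) × Adj r x)
      roots  : ∀ {x y} → par x ≡ rootMark → par y ≡ rootMark → ¬ Adj x y
      star   : ∀ {a b c} → Adj a b → Adj a c → Adj b c →
               ∃[ r ] (Span a b r × (∀ {x} → Span a b x → x ≢ r → par x ≡ suc (toℕ r)))

  finish : ∀ {par R v} → Invariant par R [] v [] → (∀ x → par x ≢ 0) → Tree par
  finish {par} {R} {v} inv seen = record
    { parent = parent
    ; roots  = roots
    ; star   = λ a∼b a∼c b∼c → let r , kr , f = stars a∼b a∼c b∼c (inj₁ refl) popped in
                 r , kr , λ kx x≢r → g (f kx x≢r)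
    }
    where
    open Invariant inv
    popped : ∀ {x} → x ∉ R
    popped {x} x∈ with waiting x∈ (seen x)
    ... | ()
    parent : ∀ x → par x ≡ rootMark ⊎ ∃[ r ] (par x ≡ suc (toℕ r) × Adj r x)
    parent x with parents x
    ... | inj₁ e = ⊥-elim (seen x e)
    ... | inj₂ p = p
    g : ∀ {x r} → par x ≡ suc (toℕ r) ⊎ (par x ≡ 0 × r ≡ v × x ∈ []) → par x ≡ suc (toℕ r)
    g (inj₁ p) = p

  -- Stars in the search forest as candidates for a maximum clique

  module Best {par} (tree : Tree par) (A : AdjacencyLists G) where
    open Tree tree
    open AdjacencyLists A

    -- Sibling or parent, put as a comparison of entries that the program can make in constant time.
    -- Two roots also pass the test; `related` rules this out for neighbours.
    Member : Node → Node → Set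
    Member v w = par w ≡ par v ⊎ suc (toℕ w) ≡ par v

    member? : ∀ v w → Dec (Member v w)
    member? v w = (par w ℕ.≟ par v) ⊎-dec (suc (toℕ w) ℕ.≟ par v)

    -- The order is the one in which the program writes the star, so the output can be matched by
    -- equality of lists.
    star-of : Node → List Node
    star-of v = v ∷ filter (member? v) (neighbours v)

    ∈-star⁻ : ∀ {v x} → x ∈ star-of v → x ≡ v ⊎ (Adj v x × Member v x)
    ∈-star⁻ (here e) = inj₁ e
    ∈-star⁻ {v} (there x∈) with ∈-filter⁻ (member? v) x∈
    ... | x∈ns , m = inj₂ (Equivalence.to adjacent x∈ns , m)

    ∈-star⁺ : ∀ {v x} → Adj v x → Member v x → x ∈ star-of v
    ∈-star⁺ {v} a m = there (∈-filter⁺ (member? v) (Equivalence.from adjacent a) m)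

    -- Adjacent nodes are not both roots, and the entry of a root names no node. So for neighbours
    -- the comparison of entries yields a genuine parent `r` of `v`.
    related : ∀ {v x} → Adj v x → Member v x →
              ∃[ r ] (par v ≡ suc (toℕ r) × Adj r v × (x ≡ r ⊎ Adj r x))
    related {v} {x} a m with parent v
    related {v} {x} a (inj₁ e) | inj₁ p = ⊥-elim (roots p (trans e p) a)
    related {v} {x} a (inj₂ e) | inj₁ p = ⊥-elim (rootMark≢ x (trans e p))
    related {v} {x} a (inj₂ e) | inj₂ (r , p , r∼v) =
      r , p , r∼v , inj₁ (toℕ-injective (suc-injective (trans e p)))
    related {v} {x} a (inj₁ e) | inj₂ (r , p , r∼v) with parent x
    ... | inj₁ q = ⊥-elim (rootMark≢ r (trans (≡.sym (trans e p)) q))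
    ... | inj₂ (r′ , q , r′∼x)
        with refl ← toℕ-injective (suc-injective (trans (≡.sym q) (trans e p))) =
      r , p , r∼v , inj₂ r′∼x

    -- Distinct siblings `x` and `y` in the star are common neighbours of the edge between `v` and
    -- its parent, so `diamond-free` joins them. Every other pair contains `v` or the parent.
    star-clique : ∀ v → IsClique G (star-of v)
    star-clique v = (All.tabulate fresh ∷ Unique.filter⁺ (member? v) (unique v)) , adj
      where
      fresh : ∀ {x} → x ∈ filter (member? v) (neighbours v) → v ≢ x
      fresh x∈ = adj⇒≢ (Equivalence.to adjacent (proj₁ (∈-filter⁻ (member? v) x∈)))

      join : ∀ {x y r} → Adj v x → Adj v y → Adj r v → x ≡ r ⊎ Adj r x → y ≡ r ⊎ Adj r y →
             x ≢ y → Adj x y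
      join _ _ _ (inj₁ refl) (inj₁ refl) n = ⊥-elim (n refl)
      join _ _ _ (inj₁ refl) (inj₂ r∼y)  _ = r∼y
      join _ _ _ (inj₂ r∼x)  (inj₁ refl) _ = sym r∼x
      join v∼x v∼y r∼v (inj₂ r∼x) (inj₂ r∼y) n = diamond-free (sym r∼v) v∼x r∼x v∼y r∼y n

      adj : ∀ {x y} → x ∈ star-of v → y ∈ star-of v → x ≢ y → Adj x y
      adj x∈ y∈ x≢y with ∈-star⁻ x∈ | ∈-star⁻ y∈
      ... | inj₁ refl    | inj₁ refl    = ⊥-elim (x≢y refl)
      ... | inj₁ refl    | inj₂ (a , _) = a
      ... | inj₂ (a , _) | inj₁ refl    = sym a
      ... | inj₂ (a , m) | inj₂ (b , m′) with related a m | related b m′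
      ...   | r , p , r∼v , c | r′ , p′ , _ , c′
              with refl ← toℕ-injective (suc-injective (trans (≡.sym p) p′)) =
        join a b r∼v c c′ x≢y

    with-parent : ∀ {x r} → par x ≡ suc (toℕ r) → Adj r x → 2 ≤ length (star-of x)
    with-parent {x} p r∼x = s≤s (∈-length
      (∈-filter⁺ (member? x) (Equivalence.from adjacent (sym r∼x)) (inj₂ (≡.sym p))))

    other : ∀ {a b : Node} {xs} → a ≢ b → ∀ r → ∃[ v ] (v ∈ a ∷ b ∷ xs × v ≢ r)
    other {a} {b} a≢b r with a ≟ r
    ... | no a≢r   = a , here refl , a≢r
    ... | yes refl = b , there (here refl) , ≢-sym a≢b

    -- A clique containing a triangle has all its nodes, except perhaps the centre `r`, as children
    -- of `r`. It thus lies in the star of any of its nodes other than `r`, while the star of `r`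
    -- looks to the parent of `r` and may miss it. Of two adjacent nodes one is not a root, and with
    -- its parent it matches a clique of size two.
    star-dominates : Node → ∀ L → IsClique G L → ∃[ v ] length L ≤ length (star-of v)
    star-dominates v [] _ = v , z≤n
    star-dominates _ (x ∷ []) _ = x , s≤s z≤n
    star-dominates _ (x ∷ y ∷ []) ((x≢y ∷ _) ∷ _ , adj) with parent x | parent y
    ... | inj₂ (r , p , r∼x) | _                  = x , with-parent p r∼x
    ... | inj₁ _             | inj₂ (r , p , r∼y) = y , with-parent p r∼y
    ... | inj₁ p             | inj₁ q             =
      ⊥-elim (roots p q (adj (here refl) (there (here refl)) x≢y))
    star-dominates _ L@(a ∷ b ∷ c ∷ _) (u@((a≢b ∷ a≢c ∷ _) ∷ (b≢c ∷ _) ∷ _) , adj)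
      with star (adj (here refl) (there (here refl)) a≢b)
                (adj (here refl) (there (there (here refl))) a≢c)
                (adj (there (here refl)) (there (there (here refl))) b≢c)
    ... | r , kr , below with other a≢b r
    ...   | v , v∈ , v≢r = v , unique-⊆⇒length≤ u cover
      where
      span : ∀ {x} → x ∈ L → Span a b x
      span {x} x∈ with x ≟ a | x ≟ b
      ... | yes p  | _      = inj₁ p
      ... | no _   | yes p  = inj₂ (inj₁ p)
      ... | no x≢a | no x≢b =
        inj₂ (inj₂ (adj (here refl) x∈ (≢-sym x≢a) , adj (there (here refl)) x∈ (≢-sym x≢b)))

      open Triangle (adj (here refl) (there (here refl)) a≢b)
                    (adj (here refl) (there (there (here refl))) a≢c)
                    (adj (there (here refl)) (there (there (here refl))) b≢c) using (clique)

      cover : ∀ {x} → x ∈ L → x ∈ star-of v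
      cover {x} x∈ with x ≟ v | x ≟ r
      ... | yes refl | _ = here refl
      ... | no x≢v | yes refl =
        ∈-star⁺ (clique (span v∈) kr v≢r) (inj₂ (≡.sym (below (span v∈) v≢r)))
      ... | no x≢v | no x≢r   = ∈-star⁺ (adj v∈ x∈ (≢-sym x≢v))
        (inj₁ (trans (below (span x∈) x≢r) (≡.sym (below (span v∈) v≢r))))

-- Arrays

update-at : ∀ {A : Set} (f : ℕ → A) {i j a} → i ≡ j → (f [ i ↦ a ]) j ≡ a
update-at f {zero}  refl = refl
update-at f {suc i} refl = update-at (f ∘ suc) {i} refl

update-off : ∀ {A : Set} (f : ℕ → A) {i j a} → i ≢ j → (f [ i ↦ a ]) j ≡ f j
update-off f {zero}  {zero}  n = ⊥-elim (n refl)
update-off f {zero}  {suc j} n = refl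
update-off f {suc i} {zero}  n = refl
update-off f {suc i} {suc j} n = update-off (f ∘ suc) {i} (n ∘ cong suc)

Segment : ∀ {n} → (ℕ → ℕ) → ℕ → List (Fin n) → Set
Segment f i []       = ⊤
Segment f i (x ∷ xs) = f i ≡ toℕ x × Segment f (suc i) xs

segment-shift : ∀ {n} (f : ℕ → ℕ) i (xs : List (Fin n)) →
                Segment (f ∘ suc) i xs → Segment f (suc i) xs
segment-shift f i []       _       = tt
segment-shift f i (x ∷ xs) (e , s) = e , segment-shift f (suc i) xs s

segment-entry : ∀ {n} as (xs : List (Fin n)) bs →
                Segment (entry (as ++ map toℕ xs ++ bs)) (length as) xs
segment-entry []       []       bs = tt
segment-entry []       (x ∷ xs) bs = refl , segment-shift _ 0 xs (segment-entry [] xs bs)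
segment-entry (a ∷ as) xs       bs = segment-shift _ (length as) xs (segment-entry as xs bs)

segment-lookup : ∀ {n} (f : ℕ → ℕ) {i} (xs : List (Fin n)) → Segment f i xs →
                 ∀ k → f (i + toℕ k) ≡ toℕ (lookup xs k)
segment-lookup f {i} (x ∷ xs) (e , _) zero    = trans (cong f (+-identityʳ i)) e
segment-lookup f {i} (x ∷ xs) (_ , s) (suc k) = trans (cong f (+-suc i (toℕ k))) (segment-lookup f xs s k)

segment-snoc : ∀ {n} (f : ℕ → ℕ) {i k a} (xs : List (Fin n)) {x} → Segment f i xs →
               k ≡ i + length xs → a ≡ toℕ x → Segment (f [ k ↦ a ]) i (xs ++ x ∷ [])
segment-snoc f {i} []       _       k≡ a≡ =
  trans (update-at f (trans k≡ (+-identityʳ i))) a≡ , tt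
segment-snoc f {i} (y ∷ xs) (e , s) k≡ a≡ =
  trans (update-off f λ k≡i → ℕ.m≢1+m+n i (trans (≡.sym k≡i) k≡i+1+)) e ,
  segment-snoc f xs s k≡i+1+ a≡
  where k≡i+1+ = trans k≡ (+-suc i (length xs))

Stack : ∀ {n} → (ℕ → ℕ) → List (Fin n) → Set
Stack f []       = ⊤
Stack f (x ∷ xs) = f (length xs) ≡ toℕ x × Stack f xs

stack-above : ∀ {n} (f : ℕ → ℕ) {k a} (xs : List (Fin n)) → length xs ≤ k →
              Stack f xs → Stack (f [ k ↦ a ]) xs
stack-above f []       _ _       = tt
stack-above f (x ∷ xs) l (e , s) =
  trans (update-off f (ℕ.<⇒≢ l ∘ ≡.sym)) e , stack-above f xs (ℕ.<⇒≤ l) s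

stack-push : ∀ {n} (f : ℕ → ℕ) {k a} (xs : List (Fin n)) {x} → k ≡ length xs → a ≡ toℕ x →
             Stack f xs → Stack (f [ k ↦ a ]) (x ∷ xs)
stack-push f xs k≡ a≡ s =
  trans (update-at f k≡) a≡ , stack-above f xs (≤-reflexive (≡.sym k≡)) s

tabulate-split : ∀ {A : Set} {n} (g : Fin n → A) v →
                 ∃[ as ] ∃[ bs ] (tabulate g ≡ as ++ g v ∷ bs × length as ≡ toℕ v)
tabulate-split g zero    = [] , _ , refl , refl
tabulate-split g (suc v) with tabulate-split (g ∘ suc) v
... | as , bs , e , l = g zero ∷ as , bs , cong (g zero ∷_) e , cong suc l

tabulate-index : ∀ {A : Set} {n} (g : Fin n → A) as {x bs} → tabulate g ≡ as ++ x ∷ bs →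
                 ∃[ v ] (g v ≡ x × toℕ v ≡ length as)
tabulate-index {n = suc n} g []       refl = zero , refl , refl
tabulate-index {n = suc n} g (a ∷ as) e with tabulate-index (g ∘ suc) as (∷-injectiveʳ e)
... | v , p , q = suc v , p , cong suc q
tabulate-index {n = zero} g []      ()
tabulate-index {n = zero} g (_ ∷ _) ()

length-concat-take : ∀ {A : Set} k (xss : List (List A)) →
                     length (concat (take k xss)) ≤ length (concat xss)
length-concat-take zero    xss        = z≤n
length-concat-take (suc k) []         = z≤n
length-concat-take (suc k) (xs ∷ xss) = begin
  length (xs ++ concat (take k xss))         ≡⟨ length-++ xs ⟩
  length xs + length (concat (take k xss))   ≤⟨ ℕ.+-monoʳ-≤ (length xs) (length-concat-take k xss) ⟩
  length xs + length (concat xss)            ≡⟨ length-++ xs ⟨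
  length (xs ++ concat xss)                  ∎
  where open ℕ.≤-Reasoning

take-map-++ : ∀ {A B : Set} (f : A → B) as bs → take (length as) (map f (as ++ bs)) ≡ map f as
take-map-++ f []       bs = refl
take-map-++ f (a ∷ as) bs = cong (f a ∷_) (take-map-++ f as bs)

-- Degree sums and the layout of the neighbour lists

module Degrees {G : Graph} (A : AdjacencyLists G) where
  open Graph G
  open AdjacencyLists A

  degree : Node → ℕ
  degree v = length (neighbours v)

  -- The currency of both time bounds: one unit for each entry of a neighbour list, and one for the
  -- constant work that a node causes by itself.
  weight : List Node → ℕ
  weight []       = 0
  weight (x ∷ xs) = suc (degree x) + weight xs

  weight-filter : ∀ {P : Node → Set} (P? : ∀ x → Dec (P x)) xs → weight (filter P? xs) ≤ weight xs
  weight-filter P? []       = z≤n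
  weight-filter P? (x ∷ xs) with P? x
  ... | yes _ = ℕ.+-monoʳ-≤ (suc (degree x)) (weight-filter P? xs)
  ... | no _  = ≤-trans (weight-filter P? xs) (ℕ.m≤n+m _ _)

  weight-without : ∀ {v} xs → v ∈ xs →
                   suc (degree v) + weight (filter (λ x → ¬? (x ≟ v)) xs) ≤ weight xs
  weight-without {v} (x ∷ xs) v∈ with x ≟ v
  ... | yes refl = ℕ.+-monoʳ-≤ (suc (degree v)) (weight-filter _ xs)
  ... | no x≢v with v∈
  ...   | here refl = ⊥-elim (x≢v refl)
  ...   | there v∈′ = begin
    suc (degree v) + (suc (degree x) + w′)  ≡⟨ ℕ.+-assoc (suc (degree v)) _ _ ⟨
    suc (degree v) + suc (degree x) + w′    ≡⟨ cong (_+ w′) (ℕ.+-comm (suc (degree v)) _) ⟩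
    suc (degree x) + suc (degree v) + w′    ≡⟨ ℕ.+-assoc (suc (degree x)) _ _ ⟩
    suc (degree x) + (suc (degree v) + w′)  ≤⟨ ℕ.+-monoʳ-≤ (suc (degree x)) (weight-without xs v∈′) ⟩
    suc (degree x) + weight xs              ∎
    where
    open ℕ.≤-Reasoning
    w′ = weight (filter (λ x → ¬? (x ≟ v)) xs)

  degree≤weight : ∀ {v xs} → v ∈ xs → suc (degree v) ≤ weight xs
  degree≤weight {xs = x ∷ xs} (here refl) = ℕ.m≤m+n _ _
  degree≤weight {xs = x ∷ xs} (there v∈)  = ≤-trans (degree≤weight v∈) (ℕ.m≤n+m _ _)

  darts : List Node → List (Node × Node)
  darts []       = []
  darts (x ∷ xs) = map (x ,_) (neighbours x) ++ darts xs

  darts-source : ∀ {x y} xs → (x , y) ∈ darts xs → x ∈ xs × Adj x y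
  darts-source (z ∷ xs) p with ∈-++⁻ (map (z ,_) (neighbours z)) p
  ... | inj₁ q with ∈-map⁻ (z ,_) q
  ...   | _ , y∈ , refl = here refl , Equivalence.to adjacent y∈
  darts-source (z ∷ xs) p | inj₂ q with darts-source xs q
  ...   | x∈ , a = there x∈ , a

  darts-unique : ∀ {xs} → Unique xs → Unique (darts xs)
  darts-unique []                  = []
  darts-unique {x ∷ xs} (x≢ ∷ u) =
    Unique.++⁺ (Unique.map⁺ ,-injectiveʳ (unique x)) (darts-unique u) disjoint
    where
    disjoint : ∀ {p} → ¬ (p ∈ map (x ,_) (neighbours x) × p ∈ darts xs)
    disjoint (p , q) with ∈-map⁻ (x ,_) p
    ... | _ , _ , refl = All.lookup x≢ (proj₁ (darts-source xs q)) refl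

  weight-darts : ∀ xs → weight xs ≡ length xs + length (darts xs)
  weight-darts []       = refl
  weight-darts (x ∷ xs) = cong suc (begin
    degree x + weight xs                          ≡⟨ cong (degree x +_) (weight-darts xs) ⟩
    degree x + (length xs + length (darts xs))    ≡⟨ ℕ.+-assoc (degree x) _ _ ⟨
    degree x + length xs + length (darts xs)      ≡⟨ cong (_+ length (darts xs)) (ℕ.+-comm (degree x) _) ⟩
    length xs + degree x + length (darts xs)      ≡⟨ ℕ.+-assoc (length xs) _ _ ⟩
    length xs + (degree x + length (darts xs))    ≡⟨ cong (length xs +_) (begin
      degree x + length (darts xs)                      ≡⟨ cong (_+ length (darts xs)) (length-map (x ,_) (neighbours x)) ⟨
      length (map (x ,_) (neighbours x)) + length (darts xs) ≡⟨ length-++ (map (x ,_) (neighbours x)) ⟨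
      length (darts (x ∷ xs))                           ∎) ⟩
    length xs + length (darts (x ∷ xs))           ∎)
    where open ≡-Reasoning

  -- The inequality half of the handshake lemma: comparing its ends shows each dart to be a listed
  -- edge or the reverse of one, and the darts are distinct.
  darts≤ : ∀ {xs} → Unique xs → length (darts xs) ≤ size + size
  darts≤ {xs} u = ≤-trans (unique-⊆⇒length≤ (darts-unique u) sub)
    (≤-reflexive (trans (length-++ edges) (cong (size +_) (length-map swap edges))))
    where
    edge⁺ : ∀ {x y} → toℕ x < toℕ y → Adj x y → (x , y) ∈ edges
    edge⁺ {x} {y} l a = ∈-filter⁺ _ (∈-cartesianProduct⁺ (∈-allFin x) (∈-allFin y)) (l , a)
    sub : ∀ {p} → p ∈ darts xs → p ∈ edges ++ map swap edges
    sub {x , y} p with darts-source xs p | ℕ.<-cmp (toℕ x) (toℕ y)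
    ... | _ , a | tri< l _ _ = ∈-++⁺ˡ (edge⁺ l a)
    ... | _ , a | tri≈ _ e _ = ⊥-elim (irrefl (toℕ-injective e) a)
    ... | _ , a | tri> _ _ l = ∈-++⁺ʳ edges (∈-map⁺ swap (edge⁺ l (sym a)))

  numbers : Node → List ℕ
  numbers v = map toℕ (neighbours v)

  offset : ℕ → ℕ
  offset = arrays (input A) 0

  entries : ℕ → ℕ
  entries = arrays (input A) 1

  module _ (v : Node) where
    private
      split = tabulate-split {n = order} (λ x → x) v
      as = proj₁ split
      bs = proj₁ (proj₂ split)
      all≡ = proj₁ (proj₂ (proj₂ split))
      at = proj₂ (proj₂ (proj₂ split))
      before = concat (map numbers as)
      after = concat (map numbers bs)

      offset≡ : offset (toℕ v) ≡ length before
      offset≡ = begin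
        length (concat (take (toℕ v) (map numbers (allFin order))))
          ≡⟨ cong₂ (λ k l → length (concat (take k (map numbers l)))) (≡.sym at) all≡ ⟩
        length (concat (take (length as) (map numbers (as ++ v ∷ bs))))
          ≡⟨ cong (length ∘ concat) (take-map-++ numbers as _) ⟩
        length before ∎
        where open ≡-Reasoning

      concat-split : ∀ cs ds → concat (map numbers (cs ++ ds)) ≡
                               concat (map numbers cs) ++ concat (map numbers ds)
      concat-split cs ds = trans (cong concat (map-++ numbers cs ds))
                                 (≡.sym (concat-++ (map numbers cs) (map numbers ds)))

    offset-suc : offset (suc (toℕ v)) ≡ offset (toℕ v) + degree v
    offset-suc = begin
      length (concat (take (suc (toℕ v)) (map numbers (allFin order))))
        ≡⟨ cong₂ (λ k l → length (concat (take k (map numbers l)))) (≡.sym at+1) all≡′ ⟩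
      length (concat (take (length (as ++ v ∷ [])) (map numbers ((as ++ v ∷ []) ++ bs))))
        ≡⟨ cong (length ∘ concat) (take-map-++ numbers (as ++ v ∷ []) bs) ⟩
      length (concat (map numbers (as ++ v ∷ [])))
        ≡⟨ cong length (concat-split as (v ∷ [])) ⟩
      length (before ++ (numbers v ++ []))
        ≡⟨ length-++ before ⟩
      length before + length (numbers v ++ [])
        ≡⟨ cong₂ _+_ (≡.sym offset≡)
             (trans (length-++ (numbers v)) (trans (+-identityʳ _) (length-map toℕ (neighbours v)))) ⟩
      offset (toℕ v) + degree v ∎
      where
      open ≡-Reasoning
      at+1 : length (as ++ v ∷ []) ≡ suc (toℕ v)
      at+1 = trans (length-++ as) (trans (ℕ.+-comm _ 1) (cong suc at))
      all≡′ : allFin order ≡ (as ++ v ∷ []) ++ bs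
      all≡′ = trans all≡ (≡.sym (++-assoc as (v ∷ []) bs))

    segment : Segment entries (offset (toℕ v)) (neighbours v)
    segment = subst₂ (λ l k → Segment (entry l) k (neighbours v)) (≡.sym entries≡) (≡.sym offset≡)
      (segment-entry before (neighbours v) after)
      where
      entries≡ : concat (map numbers (allFin order)) ≡ before ++ (numbers v ++ after)
      entries≡ = trans (cong (concat ∘ map numbers) all≡) (concat-split as (v ∷ bs))

  length-concat : ∀ xs → length (concat (map numbers xs)) ≡ length (darts xs)
  length-concat []       = refl
  length-concat (x ∷ xs) = trans (length-++ (numbers x)) (trans
    (cong₂ _+_ (trans (length-map toℕ (neighbours x)) (≡.sym (length-map (x ,_) (neighbours x))))
               (length-concat xs))
    (≡.sym (length-++ (map (x ,_) (neighbours x)))))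

  offset≤ : ∀ k → offset k ≤ size + size
  offset≤ k = begin
    offset k                                 ≤⟨ length-concat-take k (map numbers (allFin order)) ⟩
    length (concat (map numbers (allFin order))) ≡⟨ length-concat (allFin order) ⟩
    length (darts (allFin order))            ≤⟨ darts≤ (Unique.allFin⁺ order) ⟩
    size + size                              ∎
    where open ℕ.≤-Reasoning

  weight-all : weight (allFin order) ≤ order + (size + size)
  weight-all = begin
    weight (allFin order)                                ≡⟨ weight-darts (allFin order) ⟩
    length (allFin order) + length (darts (allFin order))
      ≤⟨ ℕ.+-mono-≤ (≤-reflexive (length-tabulate {n = order} (λ x → x)))
                    (darts≤ (Unique.allFin⁺ order)) ⟩
    order + (size + size)                                ∎
    where open ℕ.≤-Reasoning

-- Programs

Halts : ℕ → Program → State → (ℕ → State → Set) → Set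
Halts W P σ Φ = ∃[ τ ] ∃[ t ] ((W ⊢ P , σ ⇓ τ , t) × Φ t τ)

holds? : ∀ b σ → Dec (Holds b σ)
holds? (x ≺ y) σ = regs σ x ℕ.<? regs σ y
holds? (x ≈ y) σ = regs σ x ℕ.≟ regs σ y

-- `m` is a budget from which each round pays its own steps and its test. It falls strictly, so it
-- also serves as the termination measure. The extra unit in the bound is the last test, which
-- fails.
while-rule : ∀ {W b P} (I : ℕ → State → Set) →
             (∀ {m σ} → I m σ → Holds b σ →
              Halts W P σ λ t τ → ∃[ m′ ] (suc t + m′ ≤ m × I m′ τ)) →
             ∀ {m σ} → I m σ →
             Halts W (While b Do P) σ λ t τ → t ≤ suc m × ¬ Holds b τ × ∃[ m′ ] I m′ τ
while-rule {W} {b} {P} I body {m} = go (<-wellFounded m)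
  where
  go : ∀ {m σ} → Acc _<_ m → I m σ →
       Halts W (While b Do P) σ λ t τ → t ≤ suc m × ¬ Holds b τ × ∃[ m′ ] I m′ τ
  go {m} {σ} (acc rec) i with holds? b σ
  ... | no ¬h = σ , 1 , done ¬h , s≤s z≤n , ¬h , m , i
  ... | yes h with body i h
  ...   | ρ , s , r , m′ , s+m′<m , i′ with go (rec (≤-trans (s≤s (ℕ.m≤n+m m′ s)) s+m′<m)) i′
  ...     | τ , t , r′ , t≤ , rest =
    τ , suc (s + t) , again h r r′ ,
    s≤s (≤-trans (ℕ.+-monoʳ-≤ s t≤) (≤-trans (≤-reflexive (+-suc s m′)) s+m′<m)) , rest

-- Registers: 0 order, 1 one, 2 rootMark, 3 next candidate for a root, 4 height of the
-- stack, 5 and 6 current position in and end of a neighbour list, 7 node v, 8 v + 1,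
-- 9 neighbour w, 10 parent entry of w, 11 zero, 12 length of the output, 13 best length,
-- 14 best node, 15 parent entry of v, 16 w + 1.  Arrays: 3 parent entries, 4 stack.
pushNode : ℕ → ℕ → Program
pushNode x mark = 3 ⟦ x ⟧≔ mark ⨾ 4 ⟦ 4 ⟧≔ x ⨾ 4 ≔ 4 ⊕ 1

scanNeighbour popNode nextRoot searchStep : Program

scanNeighbour =
  9 ≔ 1 ⟦ 5 ⟧ ⨾ 10 ≔ 3 ⟦ 9 ⟧ ⨾ 5 ≔ 5 ⊕ 1 ⨾
  If 10 ≈ 11 Then pushNode 9 8 Else skip

popNode =
  4 ≔ 4 ⊖ 1 ⨾ 7 ≔ 4 ⟦ 4 ⟧ ⨾ 8 ≔ 7 ⊕ 1 ⨾ 5 ≔ 0 ⟦ 7 ⟧ ⨾ 6 ≔ 0 ⟦ 8 ⟧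

nextRoot =
  -- The pointer also takes the value n, where the untouched entry 0 would pass for an unmarked
  -- node.
  (If 3 ≺ 0 Then
     (10 ≔ 3 ⟦ 3 ⟧ ⨾ If 10 ≈ 11 Then pushNode 3 2 Else skip)
   Else skip) ⨾
  3 ≔ 3 ⊕ 1

searchStep =
  If 5 ≺ 6 Then scanNeighbour Else (If 11 ≺ 4 Then popNode Else nextRoot)

-- The loop runs up to n + 1, not n: after the last candidate n - 1 the stack must still be emptied,
-- and the pointer leaves n only when nothing is pending. Register 2 serves both as this bound and
-- as the root mark.
searchAll : Program
searchAll = (1 ≔ lit 1 ⨾ 2 ≔ 0 ⊕ 1 ⨾ 8 ≔ lit 1) ⨾ While 3 ≺ 2 Do searchStep

-- Correctness and running time of the search

module Running (G : Graph) (chordless : NoCycleWithUniqueChord G) (A : AdjacencyLists G)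
               -- Registers must hold n + 1, for the root mark and the final pointer, and up to 2 m,
               -- for positions in array 1.
               (W : ℕ) (order<W : Graph.order G < W)
               (size≤W : Graph.size G + Graph.size G ≤ W) where
  open Graph G
  open Cliques G chordless
  open Search G chordless
  open AdjacencyLists A
  open Degrees A

  1≤W : 1 ≤ W
  1≤W = ≤-trans (s≤s z≤n) order<W

  node≤W : ∀ (x : Node) → toℕ x ≤ W
  node≤W x = ℕ.<⇒≤ (ℕ.<-trans (toℕ<n x) order<W)

  suc-node≤W : ∀ (x : Node) → suc (toℕ x) ≤ W
  suc-node≤W x = ≤-trans (toℕ<n x) (ℕ.<⇒≤ order<W)

  offset≤W : ∀ k → offset k ≤ W
  offset≤W k = ≤-trans (offset≤ k) size≤W

  length≤order : ∀ {xs : List Node} → Unique xs → length xs ≤ order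
  length≤order u = ≤-trans (unique-⊆⇒length≤ u (λ {x} _ → ∈-allFin x))
                           (≤-reflexive (length-tabulate {n = order} (λ x → x)))

  par : State → Node → ℕ
  par σ x = arrays σ 3 (toℕ x)

  parent≤W : ∀ {p} → Parents p → ∀ x → p x ≤ W
  parent≤W ps x with ps x
  ... | inj₁ e                 = subst (_≤ W) (≡.sym e) z≤n
  ... | inj₂ (inj₁ e)          = subst (_≤ W) (≡.sym e) order<W
  ... | inj₂ (inj₂ (r , e , _)) = subst (_≤ W) (≡.sym e) (suc-node≤W r)

  -- A product of equations between normal forms, so that it survives writing to other
  -- registers and arrays unchanged.
  Constants : State → Set
  Constants σ = regs σ 0 ≡ order × regs σ 1 ≡ 1 × regs σ 2 ≡ suc order × regs σ 11 ≡ 0 ×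
                arrays σ 0 ≡ offset × arrays σ 1 ≡ entries

  record Searching (R Q : List Node) (v : Node) (ns : List Node) (s : ℕ) (σ : State) : Set where
    field
      invariant : Invariant (par σ) R Q v ns
      constants : Constants σ
      pointer   : regs σ 3 ≡ s
      pointer≤  : s ≤ suc order
      drained   : s ≡ suc order → Q ≡ [] × ns ≡ []
      passed    : ∀ x → toℕ x < s → par σ x ≢ 0
      height    : regs σ 4 ≡ length Q
      stack     : Stack (arrays σ 4) Q
      ahead     : Segment (arrays σ 1) (regs σ 5) ns
      limit     : regs σ 6 ≡ regs σ 5 + length ns
      limit≤    : regs σ 6 ≤ W
      mark      : regs σ 8 ≡ suc (toℕ v)

  -- The potential of the search loop. Scanning shortens the list by one, and moving the pointer
  -- lowers the last summand by one. Taking a node trades its weight, degree plus one, for a list of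
  -- length degree.
  remaining : List Node → List Node → ℕ → ℕ
  remaining R ns s = length ns + (weight R + (suc order ∸ s))

  SearchState : ℕ → State → Set
  SearchState k σ =
    ∃[ R ] ∃[ Q ] ∃[ v ] ∃[ ns ] ∃[ s ] (Searching R Q v ns s σ × remaining R ns s ≡ k)

  -- Twenty is a generous common bound; the longest branch takes nine steps. Together with the loop
  -- test it yields the factor 21.
  Progress : ℕ → State → Set
  Progress k σ = Halts W searchStep σ λ t τ → t ≤ 20 × ∃[ k′ ] (k′ < k × SearchState k′ τ)

  scan : ∀ {R Q v w ns s σ} → Searching R Q v (w ∷ ns) s σ → s ≤ order → Progress (remaining R (w ∷ ns) s) σ
  scan {R} {Q} {v} {w} {ns} {s} {σ} S s≤n = result
    where
    open Searching S
    r1 = proj₁ (proj₂ constants)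
    r11 = proj₁ (proj₂ (proj₂ (proj₂ constants)))
    w≡ = proj₁ ahead

    i+1≡ : regs σ 5 + regs σ 1 ≡ suc (regs σ 5)
    i+1≡ = trans (cong (regs σ 5 +_) r1) (ℕ.+-comm (regs σ 5) 1)

    limit′ : regs σ 6 ≡ suc (regs σ 5) + length ns
    limit′ = trans limit (+-suc (regs σ 5) (length ns))

    i<e : regs σ 5 < regs σ 6
    i<e = subst (regs σ 5 <_) (≡.sym limit′) (s≤s (ℕ.m≤m+n _ _))

    w≤ : arrays σ 1 (regs σ 5) ≤ W
    w≤ = subst (_≤ W) (≡.sym w≡) (node≤W w)

    p≤ : arrays σ 3 (arrays σ 1 (regs σ 5)) ≤ W
    p≤ = subst (λ k → arrays σ 3 k ≤ W) (≡.sym w≡) (parent≤W (Invariant.parents invariant) w)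

    i+1≤ : regs σ 5 + regs σ 1 ≤ W
    i+1≤ = subst (_≤ W) (≡.sym i+1≡) (≤-trans i<e limit≤)

    ahead′ : Segment (arrays σ 1) (regs σ 5 + regs σ 1) ns
    ahead′ = subst (λ k → Segment (arrays σ 1) k ns) (≡.sym i+1≡) (proj₂ ahead)

    limit″ : regs σ 6 ≡ (regs σ 5 + regs σ 1) + length ns
    limit″ = trans limit′ (cong (_+ length ns) (≡.sym i+1≡))

    result : Progress (remaining R (w ∷ ns) s) σ
    result with par σ w ℕ.≟ 0
    ... | no seen = _ , _ ,
      if-yes i<e (seq (assign w≤) (seq (assign p≤) (seq (assign i+1≤)
        (if-no (λ e → seen (trans (cong (arrays σ 3) (≡.sym w≡)) (trans e r11))) skip)))) ,
      ℕ.≤ᵇ⇒≤ _ 20 tt , _ , ℕ.≤-refl , R , Q , v , ns , s ,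
      record
        { invariant = Step.skipSeen invariant refl seen
        ; constants = constants
        ; pointer   = pointer
        ; pointer≤  = pointer≤
        ; drained   = λ e → ⊥-elim (ℕ.<-irrefl e (s≤s s≤n))
        ; passed    = passed
        ; height    = height
        ; stack     = stack
        ; ahead     = ahead′
        ; limit     = limit″
        ; limit≤    = limit≤
        ; mark      = mark
        } , refl
    ... | yes unseen = _ , _ ,
      if-yes i<e (seq (assign w≤) (seq (assign p≤) (seq (assign i+1≤)
        (if-yes (trans (cong (arrays σ 3) w≡) (trans unseen (≡.sym r11)))
          (seq store (seq store (assign h+1≤))))))) ,
      ℕ.≤ᵇ⇒≤ _ 20 tt , _ , ℕ.≤-refl , R , w ∷ Q , v , ns , s ,
      record
        { invariant = invariant′
        ; constants = constants
        ; pointer   = pointer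
        ; pointer≤  = pointer≤
        ; drained   = λ e → ⊥-elim (ℕ.<-irrefl e (s≤s s≤n))
        ; passed    = λ x x<s → passed′ x (passed x x<s)
        ; height    = h+1≡
        ; stack     = stack-push (arrays σ 4) Q height w≡ stack
        ; ahead     = ahead′
        ; limit     = limit″
        ; limit≤    = limit≤
        ; mark      = mark
        } , refl
      where
      cell = arrays σ 1 (regs σ 5)
      par′ : Node → ℕ
      par′ x = (arrays σ 3 [ cell ↦ regs σ 8 ]) (toℕ x)

      marked : par′ w ≡ suc (toℕ v)
      marked = trans (update-at (arrays σ 3) w≡) mark

      same : ∀ {x} → x ≢ w → par′ x ≡ par σ x
      same x≢w = update-off (arrays σ 3) (λ e → x≢w (≡.sym (toℕ-injective (trans (≡.sym w≡) e))))

      invariant′ : Invariant par′ R (w ∷ Q) v ns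
      invariant′ = Step.discover invariant refl unseen marked same

      passed′ : ∀ x → par σ x ≢ 0 → par′ x ≢ 0
      passed′ x n e = n (trans (≡.sym (same λ { refl → n unseen })) e)

      h+1≡ : regs σ 4 + regs σ 1 ≡ suc (length Q)
      h+1≡ = trans (cong₂ _+_ height r1) (ℕ.+-comm _ 1)

      h+1≤ : regs σ 4 + regs σ 1 ≤ W
      h+1≤ = subst (_≤ W) (≡.sym h+1≡)
        (≤-trans (length≤order (Invariant.distinct invariant′)) (ℕ.<⇒≤ order<W))

  take-node : ∀ {R Q v u s σ} → Searching R (u ∷ Q) v [] s σ → s ≤ order → Progress (remaining R [] s) σ
  take-node {R} {Q} {v} {u} {s} {σ} S s≤n = _ , _ ,
    if-no i≮e (if-yes nonempty
      (seq (assign h≤) (seq (assign u≤) (seq (assign u+1≤) (seq (assign (offset-at _)) (assign (offset-at _))))))) ,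
    ℕ.≤ᵇ⇒≤ _ 20 tt , _ , lighter , R without u , Q , u , neighbours u , s ,
    record
      { invariant = pop invariant adjacent
      ; constants = constants
      ; pointer   = pointer
      ; pointer≤  = pointer≤
      ; drained   = λ e → ⊥-elim (ℕ.<-irrefl e (s≤s s≤n))
      ; passed    = passed
      ; height    = h≡
      ; stack     = proj₂ stack
      ; ahead     = subst₂ (λ f k → Segment f k (neighbours u)) (≡.sym a1) (≡.sym start≡) (segment u)
      ; limit     = trans end≡ (cong (_+ degree u) (≡.sym start≡))
      ; limit≤    = offset-at _
      ; mark      = u+1≡
      } , refl
    where
    open Searching S
    r1 = proj₁ (proj₂ constants)
    r11 = proj₁ (proj₂ (proj₂ (proj₂ constants)))
    a0 = proj₁ (proj₂ (proj₂ (proj₂ (proj₂ constants))))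
    a1 = proj₂ (proj₂ (proj₂ (proj₂ (proj₂ constants))))

    i≮e : ¬ (regs σ 5 < regs σ 6)
    i≮e = subst (λ k → ¬ (regs σ 5 < k)) (≡.sym (trans limit (+-identityʳ _))) (ℕ.<-irrefl refl)

    nonempty : regs σ 11 < regs σ 4
    nonempty = subst₂ _<_ (≡.sym r11) (≡.sym height) (s≤s z≤n)

    h≡ : regs σ 4 ∸ regs σ 1 ≡ length Q
    h≡ = cong₂ _∸_ height r1

    h≤ : regs σ 4 ∸ regs σ 1 ≤ W
    h≤ = subst (_≤ W) (≡.sym h≡)
      (≤-trans (length≤order (AllPairs.tail (Invariant.distinct invariant))) (ℕ.<⇒≤ order<W))

    top : ℕ
    top = arrays σ 4 (regs σ 4 ∸ regs σ 1)

    top≡ : top ≡ toℕ u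
    top≡ = trans (cong (arrays σ 4) h≡) (proj₁ stack)

    u≤ : top ≤ W
    u≤ = subst (_≤ W) (≡.sym top≡) (node≤W u)

    u+1≡ : top + regs σ 1 ≡ suc (toℕ u)
    u+1≡ = trans (cong₂ _+_ top≡ r1) (ℕ.+-comm _ 1)

    u+1≤ : top + regs σ 1 ≤ W
    u+1≤ = subst (_≤ W) (≡.sym u+1≡) (suc-node≤W u)

    offset-at : ∀ k → arrays σ 0 k ≤ W
    offset-at k = subst (λ f → f k ≤ W) (≡.sym a0) (offset≤W k)

    start≡ : arrays σ 0 top ≡ offset (toℕ u)
    start≡ = cong₂ (λ f k → f k) a0 top≡

    end≡ : arrays σ 0 (top + regs σ 1) ≡ offset (toℕ u) + degree u
    end≡ = trans (cong₂ (λ f k → f k) a0 u+1≡) (offset-suc u)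

    lighter : degree u + (weight (R without u) + (suc order ∸ s)) < weight R + (suc order ∸ s)
    lighter = ≤-trans (≤-reflexive (cong suc (≡.sym (ℕ.+-assoc (degree u) _ _))))
      (ℕ.+-monoˡ-≤ (suc order ∸ s)
        (weight-without R (proj₁ (Invariant.onStack invariant (here refl)))))

  move-pointer : ∀ {R v s σ} → Searching R [] v [] s σ → s ≤ order → Progress (remaining R [] s) σ
  move-pointer {R} {v} {s} {σ} S s≤n = result
    where
    open Searching S
    r0 = proj₁ constants
    r1 = proj₁ (proj₂ constants)
    r2 = proj₁ (proj₂ (proj₂ constants))
    r11 = proj₁ (proj₂ (proj₂ (proj₂ constants)))

    i≮e : ¬ (regs σ 5 < regs σ 6)
    i≮e = subst (λ k → ¬ (regs σ 5 < k)) (≡.sym (trans limit (+-identityʳ _))) (ℕ.<-irrefl refl)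

    empty : ¬ (regs σ 11 < regs σ 4)
    empty l = ℕ.n≮0 (subst (regs σ 11 <_) height l)

    s+1≡ : regs σ 3 + regs σ 1 ≡ suc s
    s+1≡ = trans (cong₂ _+_ pointer r1) (ℕ.+-comm _ 1)

    s+1≤ : regs σ 3 + regs σ 1 ≤ W
    s+1≤ = subst (_≤ W) (≡.sym s+1≡) (≤-trans (s≤s s≤n) order<W)

    less : weight R + (suc order ∸ suc s) < weight R + (suc order ∸ s)
    less = ℕ.+-monoʳ-< (weight R) (ℕ.∸-monoʳ-< ℕ.≤-refl (s≤s s≤n))

    passed-suc : ∀ (p : Node → ℕ) {u} → toℕ u ≡ s → p u ≢ 0 → (∀ x → toℕ x < s → p x ≢ 0) →
                 ∀ x → toℕ x < suc s → p x ≢ 0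
    passed-suc p {u} u≡s n f x x≤s with x ≟ u
    ... | yes refl = n
    ... | no x≢u   = f x (ℕ.≤∧≢⇒< (ℕ.≤-pred x≤s) (λ e → x≢u (toℕ-injective (trans e (≡.sym u≡s)))))

    result : Progress (remaining R [] s) σ
    result with s ℕ.<? order
    ... | no s≮n = _ , _ ,
      if-no i≮e (if-no empty (seq (if-no (λ l → s≮n (subst₂ _<_ pointer r0 l)) skip) (assign s+1≤))) ,
      ℕ.≤ᵇ⇒≤ _ 20 tt , _ , less , R , [] , v , [] , suc s ,
      record
        { invariant = invariant
        ; constants = constants
        ; pointer   = s+1≡
        ; pointer≤  = s≤s s≤n
        -- Only this case can bring the pointer to n + 1, and here stack and list are empty.
        ; drained   = λ _ → refl , refl
        ; passed    = λ x _ → passed x (ℕ.<-≤-trans (toℕ<n x) (ℕ.≮⇒≥ s≮n))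
        ; height    = height
        ; stack     = tt
        ; ahead     = tt
        ; limit     = limit
        ; limit≤    = limit≤
        ; mark      = mark
        } , refl
    ... | yes s<n with par σ (fromℕ< s<n) ℕ.≟ 0
    ...   | no seen = _ , _ ,
      if-no i≮e (if-no empty (seq (if-yes s<n′ (seq (assign p≤)
        (if-no (λ e → seen (trans (cong (arrays σ 3) u≡r3) (trans e r11))) skip))) (assign s+1≤))) ,
      ℕ.≤ᵇ⇒≤ _ 20 tt , _ , less , R , [] , v , [] , suc s ,
      record
        { invariant = invariant
        ; constants = constants
        ; pointer   = s+1≡
        ; pointer≤  = s≤s s≤n
        ; drained   = λ e → ⊥-elim (ℕ.<-irrefl (ℕ.suc-injective e) s<n)
        ; passed    = passed-suc (par σ) (toℕ-fromℕ< s<n) seen passed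
        ; height    = height
        ; stack     = tt
        ; ahead     = tt
        ; limit     = limit
        ; limit≤    = limit≤
        ; mark      = mark
        } , refl
      where
      s<n′ : regs σ 3 < regs σ 0
      s<n′ = subst₂ _<_ (≡.sym pointer) (≡.sym r0) s<n
      u≡r3 : toℕ (fromℕ< s<n) ≡ regs σ 3
      u≡r3 = trans (toℕ-fromℕ< s<n) (≡.sym pointer)
      p≤ : arrays σ 3 (regs σ 3) ≤ W
      p≤ = subst (λ k → arrays σ 3 k ≤ W) u≡r3 (parent≤W (Invariant.parents invariant) (fromℕ< s<n))
    ...   | yes unseen = _ , _ ,
      if-no i≮e (if-no empty (seq (if-yes s<n′ (seq (assign p≤)
        (if-yes (trans (cong (arrays σ 3) (≡.sym u≡r3)) (trans unseen (≡.sym r11)))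
          (seq store (seq store (assign h+1≤)))))) (assign s+1≤))) ,
      ℕ.≤ᵇ⇒≤ _ 20 tt , _ , less , R , u ∷ [] , v , [] , suc s ,
      record
        { invariant = Step.restart invariant refl refl unseen marked same
        ; constants = constants
        ; pointer   = s+1≡
        ; pointer≤  = s≤s s≤n
        ; drained   = λ e → ⊥-elim (ℕ.<-irrefl (ℕ.suc-injective e) s<n)
        ; passed    = passed-suc par′ (toℕ-fromℕ< s<n) (λ e → ℕ.1+n≢0 (trans (≡.sym marked) e))
                        (λ x l → passed′ x (passed x l))
        ; height    = h+1≡
        ; stack     = stack-push (arrays σ 4) [] height (≡.sym u≡r3) tt
        ; ahead     = tt
        ; limit     = limit
        ; limit≤    = limit≤
        ; mark      = mark
        } , refl
      where
      u : Node
      u = fromℕ< s<n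
      s<n′ : regs σ 3 < regs σ 0
      s<n′ = subst₂ _<_ (≡.sym pointer) (≡.sym r0) s<n
      u≡r3 : toℕ u ≡ regs σ 3
      u≡r3 = trans (toℕ-fromℕ< s<n) (≡.sym pointer)
      p≤ : arrays σ 3 (regs σ 3) ≤ W
      p≤ = subst (λ k → arrays σ 3 k ≤ W) u≡r3 (parent≤W (Invariant.parents invariant) u)

      par′ : Node → ℕ
      par′ x = (arrays σ 3 [ regs σ 3 ↦ regs σ 2 ]) (toℕ x)

      marked : par′ u ≡ rootMark
      marked = trans (update-at (arrays σ 3) (≡.sym u≡r3)) r2

      same : ∀ {x} → x ≢ u → par′ x ≡ par σ x
      same x≢u = update-off (arrays σ 3) (λ e → x≢u (≡.sym (toℕ-injective (trans u≡r3 e))))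

      passed′ : ∀ x → par σ x ≢ 0 → par′ x ≢ 0
      passed′ x n e = n (trans (≡.sym (same λ { refl → n unseen })) e)

      h+1≡ : regs σ 4 + regs σ 1 ≡ 1
      h+1≡ = cong₂ _+_ height r1

      h+1≤ : regs σ 4 + regs σ 1 ≤ W
      h+1≤ = subst (_≤ W) (≡.sym h+1≡) 1≤W

  search-progress : ∀ {k σ} → SearchState k σ → Holds (3 ≺ 2) σ → Progress k σ
  search-progress {σ = σ} (R , Q , v , ns , s , S , refl) s<n+1 = go Q ns S
    where
    s≤n : s ≤ order
    s≤n = ℕ.≤-pred (subst₂ _<_ (Searching.pointer S) (proj₁ (proj₂ (proj₂ (Searching.constants S)))) s<n+1)
    go : ∀ Q ns → Searching R Q v ns s σ → Progress (remaining R ns s) σ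
    go Q       (w ∷ ns) S = scan S s≤n
    go (u ∷ Q) []       S = take-node S s≤n
    go []      []       S = move-pointer S s≤n

  Searched : State → Set
  Searched τ = Constants τ × Tree (par τ)

  searched : ∀ {k τ} → SearchState k τ → ¬ Holds (3 ≺ 2) τ → Searched τ
  searched {τ = τ} (R , Q , v , ns , s , S , _) s≮n+1 = constants , tree (drained s≡n+1)
    where
    open Searching S
    s≡n+1 : s ≡ suc order
    s≡n+1 = ℕ.≤-antisym pointer≤
      (subst₂ _≤_ (proj₁ (proj₂ (proj₂ constants))) pointer (ℕ.≮⇒≥ s≮n+1))
    tree : Q ≡ [] × ns ≡ [] → Tree (par τ)
    tree (refl , refl) = finish invariant λ x →
      passed x (subst (toℕ x <_) (≡.sym s≡n+1) (ℕ.m≤n⇒m≤1+n (toℕ<n x)))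

  search-runs : 0 < order →
    Halts W searchAll (input A) λ t τ → t ≤ 4 + 21 * (weight (allFin order) + suc order) × Searched τ
  search-runs 0<n with while-rule (λ m τ → ∃[ k ] (21 * k ≡ m × SearchState k τ)) body
                                  (_ , refl , start)
    where
    body : ∀ {m σ} → ∃[ k ] (21 * k ≡ m × SearchState k σ) → Holds (3 ≺ 2) σ →
           Halts W searchStep σ λ t τ →
             ∃[ m′ ] (suc t + m′ ≤ m × ∃[ k ] (21 * k ≡ m′ × SearchState k τ))
    body (k , refl , S) h with search-progress S h
    ... | τ , t , r , t≤ , k′ , k′<k , S′ = τ , t , r , 21 * k′ , bound , k′ , refl , S′
      where
      open ℕ.≤-Reasoning
      bound : suc t + 21 * k′ ≤ 21 * k
      bound = begin
        suc t + 21 * k′   ≤⟨ ℕ.+-monoˡ-≤ (21 * k′) (s≤s t≤) ⟩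
        21 + 21 * k′      ≡⟨ ℕ.*-suc 21 k′ ⟨
        21 * suc k′       ≤⟨ ℕ.*-monoʳ-≤ 21 k′<k ⟩
        21 * k            ∎

    σ₀ : State
    σ₀ = setReg 8 1 (setReg 2 (order + 1) (setReg 1 1 (input A)))
    -- No node has been taken yet. Node 0 poses as the last one, which is why register 8 starts at
    -- 1; its list is empty, so the invariant demands nothing of it.
    v₀ : Node
    v₀ = fromℕ< 0<n
    start : SearchState (weight (allFin order) + suc order) σ₀
    start = allFin order , [] , v₀ , [] , 0 , record
      { invariant = initially (λ _ → refl) ∈-allFin
      ; constants = refl , refl , ℕ.+-comm order 1 , refl , refl , refl
      ; pointer   = refl
      ; pointer≤  = z≤n
      ; drained   = λ ()
      ; passed    = λ _ ()
      ; height    = refl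
      ; stack     = tt
      ; ahead     = tt
      ; limit     = refl
      ; limit≤    = z≤n
      ; mark      = cong suc (≡.sym (toℕ-fromℕ< 0<n))
      } , refl
  ... | τ , t , r , t≤ , ¬h , m , k , _ , S = τ , _ ,
    seq (seq (assign 1≤W) (seq (assign (subst (_≤ W) (ℕ.+-comm 1 order) order<W)) (assign 1≤W))) r ,
    s≤s (s≤s (s≤s t≤)) , searched S ¬h

-- Listing the stars and keeping a largest one

appendNode listStep listStar selectBest maximumClique : Program

appendNode = 2 ⟦ 12 ⟧≔ 9 ⨾ 12 ≔ 12 ⊕ 1

listStep =
  9 ≔ 1 ⟦ 5 ⟧ ⨾ 10 ≔ 3 ⟦ 9 ⟧ ⨾ 16 ≔ 9 ⊕ 1 ⨾ 5 ≔ 5 ⊕ 1 ⨾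
  If 10 ≈ 15 Then appendNode Else (If 16 ≈ 15 Then appendNode Else skip)

listStar =
  (2 ⟦ 11 ⟧≔ 7 ⨾ 12 ≔ reg 1 ⨾ 15 ≔ 3 ⟦ 7 ⟧ ⨾ 8 ≔ 7 ⊕ 1 ⨾ 5 ≔ 0 ⟦ 7 ⟧ ⨾ 6 ≔ 0 ⟦ 8 ⟧) ⨾
  While 5 ≺ 6 Do listStep

compareStar : Program
compareStar =
  listStar ⨾ (If 13 ≺ 12 Then (13 ≔ reg 12 ⨾ 14 ≔ reg 7) Else skip) ⨾ 7 ≔ 7 ⊕ 1

selectBest =
  (7 ≔ lit 0 ⨾ 13 ≔ lit 0 ⨾ 14 ≔ lit 0) ⨾
  (While 7 ≺ 0 Do compareStar) ⨾
  -- Array 2 holds the star of the last node tried, so the best star is written again. Leftovers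
  -- beyond its length are outside the output.
  7 ≔ reg 14 ⨾ listStar ⨾ 0 ≔ reg 12

-- Register 1 still holds 0 here, so the test asks whether the graph has a node.
maximumClique = If 1 ≺ 0 Then (searchAll ⨾ selectBest) Else skip

module Selecting (G : Graph) (chordless : NoCycleWithUniqueChord G) (A : AdjacencyLists G)
                 (W : ℕ) (order<W : Graph.order G < W)
                 (size≤W : Graph.size G + Graph.size G ≤ W)
                 (p : ℕ → ℕ) (tree : Search.Tree G chordless (p ∘ toℕ)) where
  open Graph G
  open Search G chordless
  open AdjacencyLists A
  open Degrees A
  open Best tree A
  open Running G chordless A W order<W size≤W
    using (1≤W; node≤W; suc-node≤W; offset≤W; length≤order)

  p≤W : ∀ (x : Node) → p (toℕ x) ≤ W
  p≤W x with Tree.parent tree x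
  ... | inj₁ e           = subst (_≤ W) (≡.sym e) order<W
  ... | inj₂ (r , e , _) = subst (_≤ W) (≡.sym e) (suc-node≤W r)

  star≤order : ∀ v → length (star-of v) ≤ order
  star≤order v = length≤order (proj₁ (star-clique v))

  Fixed : State → Set
  Fixed σ = regs σ 0 ≡ order × regs σ 1 ≡ 1 × regs σ 11 ≡ 0 ×
            arrays σ 0 ≡ offset × arrays σ 1 ≡ entries × arrays σ 3 ≡ p

  Kept : Node → ℕ → ℕ → State → Set
  Kept v b c σ = regs σ 7 ≡ toℕ v × regs σ 13 ≡ b × regs σ 14 ≡ c

  record Listing (v : Node) (b c : ℕ) (K ns : List Node) (σ : State) : Set where
    field
      fixed  : Fixed σ
      kept   : Kept v b c σ
      split  : K ++ filter (member? v) ns ≡ star-of v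
      stored : Segment (arrays σ 2) 0 K
      count  : regs σ 12 ≡ length K
      own    : regs σ 15 ≡ p (toℕ v)
      ahead  : Segment (arrays σ 1) (regs σ 5) ns
      limit  : regs σ 6 ≡ regs σ 5 + length ns
      limit≤ : regs σ 6 ≤ W

  -- Eight steps for the longest branch of `listStep` and one for the loop test give the factor 9.
  ListState : Node → ℕ → ℕ → ℕ → State → Set
  ListState v b c m σ = ∃[ K ] ∃[ ns ] (Listing v b c K ns σ × 9 * length ns ≡ m)

  list-step : ∀ {v b c m σ} → ListState v b c m σ → Holds (5 ≺ 6) σ →
              Halts W listStep σ λ t τ → ∃[ m′ ] (suc t + m′ ≤ m × ListState v b c m′ τ)
  list-step {σ = σ} (K , [] , L , _) h =
    ⊥-elim (ℕ.<-irrefl refl (subst (regs σ 5 <_) (trans (Listing.limit L) (+-identityʳ _)) h))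
  list-step {v} {b} {c} {_} {σ} (K , w ∷ ns , L , refl) h = result
    where
    open Listing L
    r1 = proj₁ (proj₂ fixed)
    a3 = proj₂ (proj₂ (proj₂ (proj₂ (proj₂ fixed))))
    w≡ = proj₁ ahead

    cell q : ℕ
    cell = arrays σ 1 (regs σ 5)
    q = arrays σ 3 cell

    q≡ : q ≡ p (toℕ w)
    q≡ = cong₂ (λ f k → f k) a3 w≡

    w+1≡ : cell + regs σ 1 ≡ suc (toℕ w)
    w+1≡ = trans (cong₂ _+_ w≡ r1) (ℕ.+-comm _ 1)

    i+1≡ : regs σ 5 + regs σ 1 ≡ suc (regs σ 5)
    i+1≡ = trans (cong (regs σ 5 +_) r1) (ℕ.+-comm (regs σ 5) 1)

    w≤ : cell ≤ W
    w≤ = subst (_≤ W) (≡.sym w≡) (node≤W w)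

    q≤ : q ≤ W
    q≤ = subst (_≤ W) (≡.sym q≡) (p≤W w)

    w+1≤ : cell + regs σ 1 ≤ W
    w+1≤ = subst (_≤ W) (≡.sym w+1≡) (suc-node≤W w)

    i+1≤ : regs σ 5 + regs σ 1 ≤ W
    i+1≤ = subst (_≤ W) (≡.sym i+1≡) (≤-trans h limit≤)

    ahead′ : Segment (arrays σ 1) (regs σ 5 + regs σ 1) ns
    ahead′ = subst (λ k → Segment (arrays σ 1) k ns) (≡.sym i+1≡) (proj₂ ahead)

    limit′ : regs σ 6 ≡ (regs σ 5 + regs σ 1) + length ns
    limit′ = trans limit (trans (+-suc (regs σ 5) (length ns)) (cong (_+ length ns) (≡.sym i+1≡)))

    cost : ∀ t → t ≤ 8 → suc t + 9 * length ns ≤ 9 * suc (length ns)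
    cost t t≤ = ≤-trans (ℕ.+-monoˡ-≤ (9 * length ns) (s≤s t≤)) (≤-reflexive (≡.sym (ℕ.*-suc 9 (length ns))))

    module Accept (m : Member v w) where
      σ₁ : State
      σ₁ = setReg 5 (regs σ 5 + regs σ 1) (setReg 16 (cell + regs σ 1) (setReg 10 q (setReg 9 cell σ)))

      split′ : (K ++ w ∷ []) ++ filter (member? v) ns ≡ star-of v
      split′ = trans (++-assoc K (w ∷ []) _)
        (trans (cong (K ++_) (≡.sym (filter-accept (member? v) m))) split)

      l+1≡ : regs σ 12 + regs σ 1 ≡ length (K ++ w ∷ [])
      l+1≡ = trans (cong₂ _+_ count r1) (≡.sym (length-++ K))

      l+1≤ : regs σ 12 + regs σ 1 ≤ W
      l+1≤ = begin
        regs σ 12 + regs σ 1          ≡⟨ l+1≡ ⟩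
        length (K ++ w ∷ [])          ≤⟨ ℕ.m≤m+n _ _ ⟩
        length (K ++ w ∷ []) + length (filter (member? v) ns) ≡⟨ length-++ (K ++ w ∷ []) ⟨
        length ((K ++ w ∷ []) ++ filter (member? v) ns) ≡⟨ cong length split′ ⟩
        length (star-of v)            ≤⟨ star≤order v ⟩
        order                         ≤⟨ ℕ.<⇒≤ order<W ⟩
        W                             ∎
        where open ℕ.≤-Reasoning

      listing : Listing v b c (K ++ w ∷ []) ns
                  (setReg 12 (regs σ 12 + regs σ 1) (setCell 2 (regs σ 12) cell σ₁))
      listing = record
        { fixed  = fixed
        ; kept   = kept
        ; split  = split′
        ; stored = segment-snoc (arrays σ 2) K stored count w≡
        ; count  = l+1≡
        ; own    = own
        ; ahead  = ahead′
        ; limit  = limit′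
        ; limit≤ = limit≤
        }

    result : Halts W listStep σ λ t τ →
               ∃[ m′ ] (suc t + m′ ≤ 9 * suc (length ns) × ListState v b c m′ τ)
    result with p (toℕ w) ℕ.≟ p (toℕ v) | suc (toℕ w) ℕ.≟ p (toℕ v)
    ... | yes e | _ = _ , _ ,
      seq (assign w≤) (seq (assign q≤) (seq (assign w+1≤) (seq (assign i+1≤)
        (if-yes (trans q≡ (trans e (≡.sym own))) (seq store (assign (Accept.l+1≤ (inj₁ e)))))))) ,
      _ , cost 7 (ℕ.≤ᵇ⇒≤ 7 8 tt) , _ , ns , Accept.listing (inj₁ e) , refl
    ... | no ¬e | yes e = _ , _ ,
      seq (assign w≤) (seq (assign q≤) (seq (assign w+1≤) (seq (assign i+1≤)
        (if-no (λ e → ¬e (trans (≡.sym q≡) (trans e own)))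
          (if-yes (trans w+1≡ (trans e (≡.sym own))) (seq store (assign (Accept.l+1≤ (inj₂ e))))))))) ,
      _ , cost 8 (ℕ.≤ᵇ⇒≤ 8 8 tt) , _ , ns , Accept.listing (inj₂ e) , refl
    ... | no ¬e | no ¬e′ = _ , _ ,
      seq (assign w≤) (seq (assign q≤) (seq (assign w+1≤) (seq (assign i+1≤)
        (if-no (λ e → ¬e (trans (≡.sym q≡) (trans e own)))
          (if-no (λ e → ¬e′ (trans (≡.sym w+1≡) (trans e own))) skip))))) ,
      _ , cost 7 (ℕ.≤ᵇ⇒≤ 7 8 tt) , K , ns ,
      record
        { fixed  = fixed
        ; kept   = kept
        ; split  = trans (cong (K ++_) (≡.sym (filter-reject (member? v) [ ¬e , ¬e′ ]′))) split
        ; stored = stored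
        ; count  = count
        ; own    = own
        ; ahead  = ahead′
        ; limit  = limit′
        ; limit≤ = limit≤
        } , refl

  record Listed (v : Node) (b c : ℕ) (σ : State) : Set where
    field
      fixed  : Fixed σ
      kept   : Kept v b c σ
      stored : Segment (arrays σ 2) 0 (star-of v)
      count  : regs σ 12 ≡ length (star-of v)

  list-runs : ∀ {v b c σ} → Fixed σ → Kept v b c σ →
              Halts W listStar σ λ t τ → t ≤ 7 + 9 * degree v × Listed v b c τ
  list-runs {v} {b} {c} {σ} fixed@(_ , r1 , r11 , a0 , a1 , a3) kept@(r7 , _) =
    finished (while-rule (ListState v b c) list-step start)
    where
    v+1≡ : regs σ 7 + regs σ 1 ≡ suc (toℕ v)
    v+1≡ = trans (cong₂ _+_ r7 r1) (ℕ.+-comm _ 1)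

    own≡ : arrays σ 3 (regs σ 7) ≡ p (toℕ v)
    own≡ = cong₂ (λ f k → f k) a3 r7

    start≡ : arrays σ 0 (regs σ 7) ≡ offset (toℕ v)
    start≡ = cong₂ (λ f k → f k) a0 r7

    end≡ : arrays σ 0 (regs σ 7 + regs σ 1) ≡ offset (toℕ v) + degree v
    end≡ = trans (cong₂ (λ f k → f k) a0 v+1≡) (offset-suc v)

    offset-at : ∀ k → arrays σ 0 k ≤ W
    offset-at k = subst (λ f → f k ≤ W) (≡.sym a0) (offset≤W k)

    σ₁ : State
    σ₁ = setReg 6 (arrays σ 0 (regs σ 7 + regs σ 1)) (setReg 5 (arrays σ 0 (regs σ 7))
           (setReg 8 (regs σ 7 + regs σ 1) (setReg 15 (arrays σ 3 (regs σ 7))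
             (setReg 12 (regs σ 1) (setCell 2 (regs σ 11) (regs σ 7) σ)))))

    start : ListState v b c (9 * degree v) σ₁
    start = v ∷ [] , neighbours v , record
      { fixed  = fixed
      ; kept   = kept
      ; split  = refl
      ; stored = segment-snoc (arrays σ 2) [] tt r11 r7
      ; count  = r1
      ; own    = own≡
      ; ahead  = subst₂ (λ f k → Segment f k (neighbours v)) (≡.sym a1) (≡.sym start≡) (segment v)
      ; limit  = trans end≡ (cong (_+ degree v) (≡.sym start≡))
      ; limit≤ = offset-at _
      } , refl

    setup : W ⊢ (2 ⟦ 11 ⟧≔ 7 ⨾ 12 ≔ reg 1 ⨾ 15 ≔ 3 ⟦ 7 ⟧ ⨾ 8 ≔ 7 ⊕ 1 ⨾ 5 ≔ 0 ⟦ 7 ⟧ ⨾ 6 ≔ 0 ⟦ 8 ⟧) ,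
              σ ⇓ σ₁ , 6
    setup = seq store (seq (assign (subst (_≤ W) (≡.sym r1) 1≤W))
      (seq (assign (subst (_≤ W) (≡.sym own≡) (p≤W v)))
      (seq (assign (subst (_≤ W) (≡.sym v+1≡) (suc-node≤W v)))
      (seq (assign (offset-at _)) (assign (offset-at _))))))

    finished : Halts W (While 5 ≺ 6 Do listStep) σ₁ (λ t τ →
                 t ≤ suc (9 * degree v) × ¬ Holds (5 ≺ 6) τ × ∃[ m ] ListState v b c m τ) →
               Halts W listStar σ λ t τ → t ≤ 7 + 9 * degree v × Listed v b c τ
    finished (τ , t , r , t≤ , ¬h , _ , K , w ∷ ns , L , _) =
      ⊥-elim (¬h (subst (regs τ 5 <_) (≡.sym (trans (Listing.limit L) (+-suc _ _))) (s≤s (ℕ.m≤m+n _ _))))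
    finished (τ , t , r , t≤ , ¬h , _ , K , [] , L , _) =
      τ , 6 + t , seq setup r , ℕ.+-monoʳ-≤ 6 t≤ , record
        { fixed  = Listing.fixed L
        ; kept   = Listing.kept L
        ; stored = subst (Segment (arrays τ 2) 0) K≡ (Listing.stored L)
        ; count  = trans (Listing.count L) (cong length K≡)
        }
      where
      K≡ : K ≡ star-of v
      K≡ = trans (≡.sym (++-identityʳ K)) (Listing.split L)

  record Selection (tried rest : List Node) (σ : State) : Set where
    field
      fixed  : Fixed σ
      cover  : allFin order ≡ tried ++ rest
      at     : regs σ 7 ≡ length tried
      best   : Node
      best≡  : regs σ 14 ≡ toℕ best
      bound  : regs σ 13 ≤ length (star-of best)
      beaten : ∀ {x} → x ∈ tried → length (star-of x) ≤ regs σ 13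

  SelectState : ℕ → State → Set
  SelectState m σ = ∃[ tried ] ∃[ rest ] (Selection tried rest σ × 12 * weight rest ≡ m)

  length-cover : ∀ {tried rest} → allFin order ≡ tried ++ rest → order ≡ length tried + length rest
  length-cover {tried} e = trans (≡.sym (length-tabulate {n = order} (λ x → x)))
                                (trans (cong length e) (length-++ tried))

  select-step : ∀ {m σ} → SelectState m σ → Holds (7 ≺ 0) σ →
                Halts W compareStar σ λ t τ → ∃[ m′ ] (suc t + m′ ≤ m × SelectState m′ τ)
  select-step {σ = σ} (tried , [] , S , _) h = ⊥-elim (ℕ.<-irrefl refl (subst₂ _<_ at r0 h))
    where
    open Selection S
    r0 : regs σ 0 ≡ length tried
    r0 = trans (proj₁ fixed) (trans (length-cover {tried} cover) (+-identityʳ _))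
  select-step {σ = σ} (tried , v ∷ rest , S , refl) h =
    continue (list-runs (Selection.fixed S) (trans (Selection.at S) (≡.sym v≡) , refl , refl))
    where
    v≡ : toℕ v ≡ length tried
    v≡ with tabulate-index {n = order} (λ x → x) tried (Selection.cover S)
    ... | _ , refl , e = e

    cover′ : allFin order ≡ (tried ++ v ∷ []) ++ rest
    cover′ = trans (Selection.cover S) (≡.sym (++-assoc tried (v ∷ []) rest))

    -- One step for the loop test, `7 + 9 * degree v` for the listing and at most 4 for the
    -- comparison and the increment: the constants add up to 12, which the unit that `weight` grants
    -- each node pays for.
    cost : ∀ {t} k → k ≤ 4 → t ≤ 7 + 9 * degree v →
           suc (t + k) + 12 * weight rest ≤ 12 * (suc (degree v) + weight rest)
    cost {t} k k≤4 t≤ = begin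
      suc (t + k) + 12 * weight rest                    ≤⟨ ℕ.+-monoˡ-≤ _ (s≤s (ℕ.+-mono-≤ t≤ k≤4)) ⟩
      suc (7 + 9 * degree v + 4) + 12 * weight rest     ≡⟨ cong (_+ 12 * weight rest) (ℕ.+-comm (8 + 9 * degree v) 4) ⟩
      12 + 9 * degree v + 12 * weight rest              ≤⟨ ℕ.+-monoˡ-≤ _ (ℕ.+-monoʳ-≤ 12
                                                                (ℕ.*-monoˡ-≤ (degree v) (ℕ.≤ᵇ⇒≤ 9 12 tt))) ⟩
      12 + 12 * degree v + 12 * weight rest             ≡⟨ cong (_+ 12 * weight rest) (ℕ.*-suc 12 (degree v)) ⟨
      12 * suc (degree v) + 12 * weight rest            ≡⟨ ℕ.*-distribˡ-+ 12 (suc (degree v)) (weight rest) ⟨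
      12 * (suc (degree v) + weight rest)               ∎
      where open ℕ.≤-Reasoning

    continue : Halts W listStar σ (λ t τ → t ≤ 7 + 9 * degree v × Listed v (regs σ 13) (regs σ 14) τ) →
               Halts W compareStar σ λ t τ →
                 ∃[ m′ ] (suc t + m′ ≤ 12 * (suc (degree v) + weight rest) × SelectState m′ τ)
    continue (ρ , t , r , t≤ , L) = result
      where
      open Selection S
      module L = Listed L
      r1 = proj₁ (proj₂ L.fixed)
      r7 = proj₁ L.kept
      r13 = proj₁ (proj₂ L.kept)
      r14 = proj₂ (proj₂ L.kept)

      v+1≡ : regs ρ 7 + regs ρ 1 ≡ suc (toℕ v)
      v+1≡ = trans (cong₂ _+_ r7 r1) (ℕ.+-comm _ 1)

      v+1≤ : regs ρ 7 + regs ρ 1 ≤ W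
      v+1≤ = subst (_≤ W) (≡.sym v+1≡) (suc-node≤W v)

      at′ : regs ρ 7 + regs ρ 1 ≡ length (tried ++ v ∷ [])
      at′ = trans v+1≡ (trans (cong suc v≡) (trans (ℕ.+-comm 1 _) (≡.sym (length-++ tried))))

      l≤ : regs ρ 12 ≤ W
      l≤ = subst (_≤ W) (≡.sym L.count) (≤-trans (star≤order v) (ℕ.<⇒≤ order<W))

      beaten′ : ∀ k → regs σ 13 ≤ k → length (star-of v) ≤ k →
                ∀ {x} → x ∈ tried ++ v ∷ [] → length (star-of x) ≤ k
      beaten′ k old new x∈ with ∈-++⁻ tried x∈
      ... | inj₁ x∈tried      = ≤-trans (beaten x∈tried) old
      ... | inj₂ (here refl) = new

      result : Halts W compareStar σ λ t τ →
                 ∃[ m′ ] (suc t + m′ ≤ 12 * (suc (degree v) + weight rest) × SelectState m′ τ)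
      result with regs ρ 13 ℕ.<? regs ρ 12
      ... | yes l = _ , _ ,
        seq r (seq (if-yes l (seq (assign l≤) (assign (subst (_≤ W) (≡.sym r7) (node≤W v))))) (assign v+1≤)) ,
        _ , cost _ (ℕ.≤ᵇ⇒≤ _ 4 tt) t≤ , tried ++ v ∷ [] , rest ,
        record
          { fixed  = L.fixed
          ; cover  = cover′
          ; at     = at′
          ; best   = v
          ; best≡  = r7
          ; bound  = ≤-reflexive L.count
          ; beaten = beaten′ (regs ρ 12) (subst (_≤ regs ρ 12) r13 (ℕ.<⇒≤ l)) (≤-reflexive (≡.sym L.count))
          } , refl
      ... | no ¬l = _ , _ ,
        seq r (seq (if-no ¬l skip) (assign v+1≤)) ,
        _ , cost _ (ℕ.≤ᵇ⇒≤ _ 4 tt) t≤ , tried ++ v ∷ [] , rest ,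
        record
          { fixed  = L.fixed
          ; cover  = cover′
          ; at     = at′
          ; best   = best
          ; best≡  = trans r14 best≡
          ; bound  = subst (_≤ length (star-of best)) (≡.sym r13) bound
          ; beaten = beaten′ (regs ρ 13) (≤-reflexive (≡.sym r13))
                       (subst₂ _≤_ L.count refl (ℕ.≮⇒≥ ¬l))
          } , refl

  select-runs : ∀ {σ} → 0 < order → Fixed σ →
    Halts W selectBest σ λ t τ → t ≤ 13 + 21 * weight (allFin order) ×
      ∃[ K ] (Outputs {G} τ K × IsMaximumClique G K)
  select-runs {σ} 0<n fixed = phase₂ (while-rule SelectState select-step start)
    where
    σ₁ : State
    σ₁ = setReg 14 0 (setReg 13 0 (setReg 7 0 σ))

    start : SelectState (12 * weight (allFin order)) σ₁
    start = [] , allFin order , record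
      { fixed  = fixed
      ; cover  = refl
      ; at     = refl
      -- Length 0 is below that of any star, so any node could be named; the 0 in register 14 makes
      -- it node 0.
      ; best   = fromℕ< 0<n
      ; best≡  = ≡.sym (toℕ-fromℕ< 0<n)
      ; bound  = z≤n
      ; beaten = λ ()
      } , refl

    phase₂ : Halts W (While 7 ≺ 0 Do compareStar) σ₁ (λ t τ →
               t ≤ suc (12 * weight (allFin order)) × ¬ Holds (7 ≺ 0) τ × ∃[ m ] SelectState m τ) →
             Halts W selectBest σ λ t τ → t ≤ 13 + 21 * weight (allFin order) ×
               ∃[ K ] (Outputs {G} τ K × IsMaximumClique G K)
    phase₂ (ρ , s , r , s≤ , ¬h , _ , tried , x ∷ rest , S , _) = ⊥-elim (¬h
      (subst₂ _<_ (≡.sym at) (≡.sym (trans (proj₁ (Selection.fixed S)) (length-cover {tried} cover)))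
        (ℕ.m<m+n (length tried) (s≤s z≤n))))
      where open Selection S using (at; cover)
    phase₂ (ρ , s , r , s≤ , ¬h , _ , tried , [] , S , _) =
      phase₃ (list-runs {v = best} {σ = setReg 7 (regs ρ 14) ρ} (Selection.fixed S) (best≡ , refl , refl))
      where
      open Selection S hiding (fixed)

      all-tried : ∀ x → x ∈ tried
      all-tried x = subst (x ∈_) (trans cover (++-identityʳ tried)) (∈-allFin x)

      longest : ∀ L → IsClique G L → length L ≤ length (star-of best)
      longest L cl = let v , l = star-dominates best L cl in
        ≤-trans l (≤-trans (beaten (all-tried v)) bound)

      phase₃ : Halts W listStar (setReg 7 (regs ρ 14) ρ) (λ t τ →
                 t ≤ 7 + 9 * degree best × Listed best (regs ρ 13) (regs ρ 14) τ) →
               Halts W selectBest σ λ t τ → t ≤ 13 + 21 * weight (allFin order) ×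
                 ∃[ K ] (Outputs {G} τ K × IsMaximumClique G K)
      phase₃ (τ , t , r′ , t≤ , L) = _ , _ ,
        seq (seq (assign z≤n) (seq (assign z≤n) (assign z≤n)))
          (seq r (seq (assign (subst (_≤ W) (≡.sym best≡) (node≤W best)))
            (seq r′ (assign (subst (_≤ W) (≡.sym count) (≤-trans (star≤order best) (ℕ.<⇒≤ order<W))))))) ,
        time , star-of best ,
        (count , segment-lookup (arrays τ 2) (star-of best) stored) ,
        (star-clique best , longest)
        where
        open Listed L using (count; stored)
        w = weight (allFin order)
        time : 3 + (s + (1 + (t + 1))) ≤ 13 + 21 * w
        time = begin
          3 + (s + (1 + (t + 1)))                       ≤⟨ ℕ.+-monoʳ-≤ 3 (ℕ.+-mono-≤ s≤ (s≤s (ℕ.+-monoˡ-≤ 1 t≤))) ⟩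
          3 + (suc (12 * w) + (1 + (7 + 9 * degree best + 1)))
            ≡⟨ solve 2 (λ a d → con 3 :+ (con 1 :+ con 12 :* a :+ (con 1 :+ (con 7 :+ con 9 :* d :+ con 1)))
                                := con 13 :+ (con 12 :* a :+ con 9 :* d)) refl w (degree best) ⟩
          13 + (12 * w + 9 * degree best)               ≤⟨ ℕ.+-monoʳ-≤ 13 (ℕ.+-monoʳ-≤ (12 * w)
                                                            (ℕ.*-monoʳ-≤ 9 (ℕ.<⇒≤ (degree≤weight (∈-allFin best))))) ⟩
          13 + (12 * w + 9 * w)                         ≡⟨ cong (13 +_) (ℕ.*-distribʳ-+ w 12 9) ⟨
          13 + 21 * w                                   ∎
          where
          open ℕ.≤-Reasoning
          open +-*-Solver

-- The search costs 21 times 2N + N and the selection 21 times 2N, together 105 N. The constants 5,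
-- which includes the outer test, and 13 are absorbed by 18 N because N is positive.
total-time : ∀ {s t w n} N → s ≤ 4 + 21 * (w + suc n) → t ≤ 13 + 21 * w → w ≤ 2 * N → n < N →
             suc (s + t) ≤ 123 * N
total-time {s} {t} {w} {n} N s≤ t≤ w≤ n<N = begin
  suc s + t                                              ≤⟨ ℕ.+-mono-≤ (s≤s s≤) t≤ ⟩
  5 + 21 * (w + suc n) + (13 + 21 * w)
    ≤⟨ ℕ.+-mono-≤ (ℕ.+-monoʳ-≤ 5 (ℕ.*-monoʳ-≤ 21 (ℕ.+-mono-≤ w≤ n<N)))
                  (ℕ.+-monoʳ-≤ 13 (ℕ.*-monoʳ-≤ 21 w≤)) ⟩
  5 + 21 * (2 * N + N) + (13 + 21 * (2 * N))
    ≡⟨ solve 1 (λ x → con 5 :+ con 21 :* (con 2 :* x :+ x) :+ (con 13 :+ con 21 :* (con 2 :* x))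
                      := con 18 :+ con 105 :* x) refl N ⟩
  18 + 105 * N                                           ≤⟨ ℕ.+-monoˡ-≤ (105 * N) (ℕ.*-monoʳ-≤ 18 (≤-trans (s≤s z≤n) n<N)) ⟩
  18 * N + 105 * N                                       ≡⟨ ℕ.*-distribʳ-+ N 18 105 ⟨
  123 * N                                                ∎
  where
  open ℕ.≤-Reasoning
  open +-*-Solver

maximumClique-correct :
  (G : Graph) → NoCycleWithUniqueChord G → (A : AdjacencyLists G) →
  ∀ {N W} → N ≡ Graph.order G + Graph.size G + 1 → W ≡ 123 * N →
  ∃[ τ ] ∃[ t ] ∃[ K ]
    ((W ⊢ maximumClique , input A ⇓ τ , t) × t ≤ W × Outputs {G} τ K × IsMaximumClique G K)
maximumClique-correct G chordless A {N} {W} N≡ W≡ with 0 ℕ.<? Graph.order G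
... | yes 0<n = nonempty
  where
  open Graph G
  open Degrees A

  order<N : order < N
  order<N = subst (order <_) (≡.sym N≡)
    (≤-trans (≤-reflexive (ℕ.+-comm 1 order)) (ℕ.+-monoˡ-≤ 1 (ℕ.m≤m+n order size)))

  order+size≤N : order + size ≤ N
  order+size≤N = subst (order + size ≤_) (≡.sym N≡) (ℕ.m≤m+n (order + size) 1)

  order+2size≤2N : order + (size + size) ≤ 2 * N
  order+2size≤2N = begin
    order + (size + size)   ≡⟨ ℕ.+-assoc order size size ⟨
    order + size + size     ≤⟨ ℕ.+-mono-≤ order+size≤N (ℕ.m+n≤o⇒n≤o order order+size≤N) ⟩
    N + N                   ≡⟨ cong (N +_) (+-identityʳ N) ⟨
    2 * N                   ∎
    where open ℕ.≤-Reasoning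

  2N≤W : 2 * N ≤ W
  2N≤W = subst (2 * N ≤_) (≡.sym W≡) (ℕ.*-monoˡ-≤ N (ℕ.≤ᵇ⇒≤ 2 123 tt))

  order<W : order < W
  order<W = ≤-trans order<N (≤-trans (ℕ.m≤m+n N _) 2N≤W)

  size≤W : size + size ≤ W
  size≤W = ≤-trans (ℕ.m+n≤o⇒n≤o order order+2size≤2N) 2N≤W

  nonempty : ∃[ τ ] ∃[ t ] ∃[ K ]
    ((W ⊢ maximumClique , input A ⇓ τ , t) × t ≤ W × Outputs {G} τ K × IsMaximumClique G K)
  nonempty with Running.search-runs G chordless A W order<W size≤W 0<n
  ... | ρ , s , r , s≤ , (r0 , r1 , _ , r11 , a0 , a1) , tree
      with Selecting.select-runs G chordless A W order<W size≤W (arrays ρ 3) tree 0<n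
             (r0 , r1 , r11 , a0 , a1 , refl)
  ...   | τ , t , r′ , t≤ , K , out , best =
    τ , suc (s + t) , K , if-yes 0<n (seq r r′) ,
    subst (suc (s + t) ≤_) (≡.sym W≡) (total-time N s≤ t≤ (≤-trans weight-all order+2size≤2N) order<N) ,
    out , best
-- Without nodes the input is already the output: register 0 holds the order 0, which is the length
-- of the empty clique.
... | no n≯0 = input A , 1 + 1 , [] , if-no n≯0 skip ,
  subst (2 ≤_) (≡.sym W≡) (ℕ.*-mono-≤ (ℕ.≤ᵇ⇒≤ 2 123 tt) 1≤N) ,
  (n≡0 , λ ()) , ([] , λ ()) , λ L cl → ≤-reflexive (no-nodes L n≡0)
  where
  n≡0 : Graph.order G ≡ 0
  n≡0 = ℕ.n≤0⇒n≡0 (ℕ.≮⇒≥ n≯0)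

  1≤N : 1 ≤ N
  1≤N = subst (1 ≤_) (≡.sym N≡) (ℕ.m≤n+m 1 _)

  no-nodes : ∀ {n} (L : List (Fin n)) → n ≡ 0 → length L ≡ 0
  no-nodes []       _    = refl
  no-nodes (() ∷ _) refl

theorem7p1 : ∃[ P ] LinearTimeAlgorithm NoCycleWithUniqueChord IsMaximumClique P
theorem7p1 = maximumClique , 123 , λ G chordless A → maximumClique-correct G chordless A refl refl
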